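{- There exists a universal constant $c>0$ such that for every integer $k\ge 2$ and every $P_k$-free tournament $T$ on $n\ge 1$ vertices, the dichromatic number of $T$ satisfies $$\chi_a(T)\le n^{1-\frac{c}{k(\log k)^2}}.$$
   Context: All graphs are finite and simple. A tournament is a directed graph in which for every two distinct vertices $u,v$ exactly one of $(u,v),(v,u)$ is an edge. Logarithms are to base two. The directed path $P_k$ is the tournament with vertex set $\{v_1,\dots,v_k\}$ in which, for $1\le i<j\le k$, the edge between $v_i$ and $v_j$ is $(v_j,v_i)$ if $j=i+1$ and $(v_i,v_j)$ otherwise. A tournament is $P_k$-free if it has no induced subtournament isomorphic to $P_k$. An acyclic coloring of a digraph $D$ is a coloring of its vertices such that every color class induces an acyclic digraph; the dichromatic number $\chi_a(D)$ is the minimum number of colors in an acyclic coloring of $D$. -}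

module Defs where

open import Level using (0ℓ)
open import Data.Nat.Base as ℕ using (ℕ; zero; suc; NonZero)
import Data.Nat.Properties as ℕ
open import Data.Integer.Base as ℤ using (ℤ; +_; -[1+_])
open import Data.Rational.Base as ℚ using (ℚ; 0ℚ; 1ℚ; _⊓_; _⊔_; ↥_; ↧ₙ_)
open import Algebra.Definitions.RawSemiring ℚ.+-*-rawSemiring using () renaming (_^_ to _^ℚ_)
open import Data.Fin.Base as Fin using (Fin; zero; suc; toℕ; fromℕ; inject₁)
import Data.Fin.Properties as Fin
open import Data.Fin.Subset using (Subset; _∈_)
open import Data.Fin.Subset.Properties using (_∈?_)
open import Data.Vec.Base using (tabulate)
open import Data.Vec.Properties using (tabulate-cong; lookup∘tabulate; []=⇒lookup)
open import Data.Vec.Properties.WithK using ([]=-irrelevant)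
open import Data.Product using (∃; ∃₂; ∃-syntax; Σ-syntax; _×_; _,_; proj₁; proj₂)
open import Data.Sum.Base using (_⊎_; inj₁; inj₂)
open import Data.Empty using (⊥-elim)
open import Function.Base using (_∘_; id)
open import Function.Bundles using (_↔_; _⇔_; Inverse)
open import Function.Definitions using (Injective)
open import Relation.Binary.Core using (Rel)
open import Relation.Binary.Definitions using (Decidable; DecidableEquality)
open import Relation.Binary.PropositionalEquality using (_≡_; _≢_; _≗_; refl; sym; trans; cong; subst; subst₂)
open import Relation.Nullary using (¬_; Dec; yes; no; does)
open import Relation.Nullary.Decidable using (map′; _×-dec_; _⊎-dec_; _→-dec_; ¬?)
import Relation.Unary as U

private
  variable
    V W : Set
    n m : ℕ

record Digraph (V : Set) : Set₁ where
  field
    E      : Rel V 0ℓ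
    E?     : Decidable E
    irrefl : ∀ v → ¬ E v v

open Digraph

IsTournament : Digraph V → Set
IsTournament D = ∀ u v → u ≢ v → (E D u v × ¬ E D v u) ⊎ (E D v u × ¬ E D u v)

record _≅_ (D : Digraph V) (D′ : Digraph W) : Set where
  field
    bijection : V ↔ W
    edges     : ∀ u v → E D u v ⇔ E D′ (Inverse.to bijection u) (Inverse.to bijection v)

_[_] : Digraph (Fin n) → (S : Subset n) → Digraph (∃ (_∈ S))
(D [ S ]) .E u v          = E D (proj₁ u) (proj₁ v)
(D [ S ]) .E? u v         = E? D (proj₁ u) (proj₁ v)
(D [ S ]) .irrefl (v , _) = irrefl D v

_-free_ : Digraph V → Digraph (Fin n) → Set
H -free D = ¬ (∃[ S ] (D [ S ]) ≅ H)

-- The vertex v_i of P_k is the element i - 1 of Fin k.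
P : (k : ℕ) → Digraph (Fin k)
P k .E i j  = toℕ i ≡ suc (toℕ j) ⊎ (i Fin.< j × toℕ j ≢ suc (toℕ i))
P k .E? i j = (toℕ i ℕ.≟ suc (toℕ j)) ⊎-dec ((i Fin.<? j) ×-dec ¬? (toℕ j ℕ.≟ suc (toℕ i)))
P k .irrefl i (inj₁ eq)        = ℕ.1+n≢n (sym eq)
P k .irrefl i (inj₂ (i<i , _)) = ℕ.<-irrefl refl i<i

-- The cycle f 0 → f 1 → ⋯ → f l → f 0; length 1 is excluded by irrefl.
record IsDirectedCycle (D : Digraph V) {l : ℕ} (f : Fin (suc l) → V) : Set where
  constructor mkCycle
  field
    distinct : Injective _≡_ _≡_ f
    step     : (i : Fin l) → E D (f (inject₁ i)) (f (suc i))
    close    : E D (f (fromℕ l)) (f zero)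

Acyclic : Digraph V → Set
Acyclic {V} D = ∀ {l} (f : Fin (suc l) → V) → ¬ IsDirectedCycle D f

colorClass : (Fin n → Fin m) → Fin m → Subset n
colorClass c i = tabulate (λ v → does (c v Fin.≟ i))

IsAcyclicColoring : Digraph (Fin n) → (Fin n → Fin m) → Set
IsAcyclicColoring D c = ∀ i → Acyclic (D [ colorClass c i ])

AcyclicallyColorable : Digraph (Fin n) → ℕ → Set
AcyclicallyColorable {n} D m = Σ[ c ∈ (Fin n → Fin m) ] IsAcyclicColoring D c

IsDichromaticNumber : Digraph (Fin n) → ℕ → Set
IsDichromaticNumber D m =
  AcyclicallyColorable D m × (∀ m′ → AcyclicallyColorable D m′ → m ℕ.≤ m′)

-- Existence of the dichromatic number: acyclic m-colorability is
-- decidable, by exhaustive search, and holds for m = n.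

private
  Searchable : Set → Set₁
  Searchable A = {Q : A → Set} → U.Decidable Q → Dec (∃ Q)

  search-∈ : (S : Subset n) → Searchable (∃ (_∈ S))
  search-∈ S {Q} Q? =
    map′ (λ (v , p , q) → (v , p) , q) (λ ((v , p) , q) → v , p , q) (Fin.any? at?)
    where
    at? : U.Decidable (λ v → ∃ λ (p : v ∈ S) → Q (v , p))
    at? v with v ∈? S
    ... | no v∉S = no (v∉S ∘ proj₁)
    ... | yes p  = map′ (p ,_) (λ (p′ , q) → subst (λ p → Q (v , p)) ([]=-irrelevant p′ p) q) (Q? (v , p))

  cons : {A : Set} → A → (Fin m → A) → Fin (suc m) → A
  cons a f zero    = a
  cons a f (suc i) = f i

  cons-η : {A : Set} (f : Fin (suc m) → A) → cons (f zero) (f ∘ suc) ≗ f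
  cons-η f zero    = refl
  cons-η f (suc i) = refl

  search-→ : {A : Set} → Searchable A → ∀ m {Q : (Fin m → A) → Set} →
             (∀ {f g} → f ≗ g → Q f → Q g) → U.Decidable Q → Dec (∃ Q)
  search-→ s zero resp Q? = map′ (_ ,_) (λ (f , q) → resp (λ ()) q) (Q? (λ ()))
  search-→ {A} s (suc m) {Q} resp Q? =
    map′ (λ (a , f , q) → cons a f , q)
         (λ (f , q) → f zero , f ∘ suc , resp (sym ∘ cons-η f) q)
         (s (λ a → search-→ s m (λ eq → resp (λ { zero → refl ; (suc i) → eq i })) (Q? ∘ cons a)))

  module _ (D : Digraph V) where

    cycle-resp : ∀ {l} {f g : Fin (suc l) → V} → f ≗ g → IsDirectedCycle D f → IsDirectedCycle D g
    cycle-resp eq (mkCycle d s c) = mkCycle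
      (λ {x} {y} gx≡gy → d (trans (eq x) (trans gx≡gy (sym (eq y)))))
      (λ i → subst₂ (E D) (eq _) (eq _) (s i))
      (subst₂ (E D) (eq _) (eq _) c)

    cycle? : DecidableEquality V → ∀ {l} → U.Decidable (IsDirectedCycle D {l})
    cycle? _≟_ f =
      map′ (λ (d , s , c) → mkCycle (λ {x} {y} → d x y) s c)
           (λ (mkCycle d s c) → (λ x y → d) , s , c)
           (Fin.all? (λ x → Fin.all? (λ y → (f x ≟ f y) →-dec (x Fin.≟ y)))
             ×-dec Fin.all? (λ i → E? D _ _) ×-dec E? D _ _)

  ∈-≡ : {S : Subset n} {u v : ∃ (_∈ S)} → proj₁ u ≡ proj₁ v → u ≡ v
  ∈-≡ {u = u , p} {v = .u , q} refl = cong (u ,_) ([]=-irrelevant p q)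

  acyclic? : (D : Digraph (Fin n)) (S : Subset n) → Dec (Acyclic (D [ S ]))
  acyclic? {n} D S = map′ to from (¬? (Fin.any? cycleOfLength?))
    where
    _≟_ : DecidableEquality (∃ (_∈ S))
    u ≟ v = map′ ∈-≡ (cong proj₁) (proj₁ u Fin.≟ proj₁ v)

    bound : ∀ {l} {f : Fin (suc l) → ∃ (_∈ S)} → IsDirectedCycle (D [ S ]) f → l ℕ.< n
    bound (mkCycle d _ _) = Fin.injective⇒≤ (d ∘ ∈-≡)

    HasCycle : ℕ → Set
    HasCycle l = Σ[ f ∈ (Fin (suc l) → ∃ (_∈ S)) ] IsDirectedCycle (D [ S ]) f

    cycleOfLength? : U.Decidable {A = Fin n} (HasCycle ∘ toℕ)
    cycleOfLength? l =
      search-→ (search-∈ S) (suc (toℕ l)) (cycle-resp (D [ S ])) (cycle? (D [ S ]) _≟_)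

    to : ¬ ∃ (HasCycle ∘ toℕ {n}) → Acyclic (D [ S ])
    to ¬∃ f cyc = ¬∃ (Fin.fromℕ< (bound cyc) ,
      subst HasCycle (sym (Fin.toℕ-fromℕ< (bound cyc))) (f , cyc))

    from : Acyclic (D [ S ]) → ¬ ∃ (HasCycle ∘ toℕ {n})
    from acyc (l , f , cyc) = acyc f cyc

  colorClass-cong : {c d : Fin n → Fin m} → c ≗ d → ∀ i → colorClass c i ≡ colorClass d i
  colorClass-cong eq i = tabulate-cong (λ v → cong (λ x → does (x Fin.≟ i)) (eq v))

  colorable? : (D : Digraph (Fin n)) → U.Decidable (AcyclicallyColorable D)
  colorable? {n} D m = search-→ Fin.any? n
    (λ eq col i → subst (λ S → Acyclic (D [ S ])) (colorClass-cong eq i) (col i))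
    (λ c → Fin.all? (λ i → acyclic? D (colorClass c i)))

  ∈-colorClass : (c : Fin n → Fin m) (i : Fin m) {v : Fin n} → v ∈ colorClass c i → c v ≡ i
  ∈-colorClass c i {v} p
    with c v Fin.≟ i | trans (sym (lookup∘tabulate (λ v → does (c v Fin.≟ i)) v)) ([]=⇒lookup p)
  ... | yes eq | _  = eq
  ... | no _   | ()

  n-colorable : (D : Digraph (Fin n)) → AcyclicallyColorable D n
  n-colorable D = id , λ i f cyc → irrefl D i
    (subst₂ (E D) (∈-colorClass id i (proj₂ (f _))) (∈-colorClass id i (proj₂ (f _)))
            (IsDirectedCycle.close cyc))

  least : {Q : ℕ → Set} → U.Decidable Q → ∀ b → Q b → ∃[ m ] Q m × (∀ m′ → Q m′ → m ℕ.≤ m′)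
  least Q? zero q = zero , q , λ _ _ → ℕ.z≤n
  least {Q} Q? (suc b) q with Q? zero
  ... | yes q₀ = zero , q₀ , λ _ _ → ℕ.z≤n
  ... | no ¬q₀ with least (Q? ∘ suc) b q
  ...   | m , qm , min = suc m , qm , λ { zero q₀ → ⊥-elim (¬q₀ q₀) ; (suc m′) q′ → ℕ.s≤s (min m′ q′) }

dichromaticNumber : (D : Digraph (Fin n)) → ∃ (IsDichromaticNumber D)
dichromaticNumber {n} D = least (colorable? D) n (n-colorable D)

χₐ : Digraph (Fin n) → ℕ
χₐ D = proj₁ (dichromaticNumber D)

-- Real numbers as Dedekind cuts of ℚ.  The operations are given on pairs
-- of predicates by the usual formulas, so they need no proof that their
-- arguments or results are cuts; IsDedekind singles out the actual reals.

record Cut : Set₁ where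
  field
    lower : ℚ → Set
    upper : ℚ → Set

_<[_] : ℚ → Cut → Set
q <[ x ] = Cut.lower x q

[_]<_ : Cut → ℚ → Set
[ x ]< q = Cut.upper x q

infix 4 _<[_] [_]<_

record IsDedekind (x : Cut) : Set where
  field
    lower-inhabited : ∃[ q ] q <[ x ]
    upper-inhabited : ∃[ q ] [ x ]< q
    lower-rounded   : ∀ q → q <[ x ] ⇔ (∃[ r ] q ℚ.< r × r <[ x ])
    upper-rounded   : ∀ q → [ x ]< q ⇔ (∃[ r ] r ℚ.< q × [ x ]< r)
    disjoint        : ∀ q → ¬ (q <[ x ] × [ x ]< q)
    located         : ∀ q r → q ℚ.< r → q <[ x ] ⊎ [ x ]< r

infix 4 _<ᴿ_ _≤ᴿ_

_<ᴿ_ : Cut → Cut → Set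
x <ᴿ y = ∃[ q ] [ x ]< q × q <[ y ]

-- For Dedekind reals this is equivalent to inclusion of the lower sets.
_≤ᴿ_ : Cut → Cut → Set
x ≤ᴿ y = ¬ (y <ᴿ x)

fromℚ : ℚ → Cut
fromℚ p = record { lower = ℚ._< p ; upper = p ℚ.<_ }

fromℕ→ℚ : ℕ → ℚ
fromℕ→ℚ a = + a ℚ./ 1

fromℕᴿ : ℕ → Cut
fromℕᴿ a = fromℚ (fromℕ→ℚ a)

infixl 6 _-ᴿ_
infixl 7 _*ᴿ_ _/ᴿ_

_-ᴿ_ : Cut → Cut → Cut
x -ᴿ y = record
  { lower = λ q → ∃₂ λ a b → a <[ x ] × [ y ]< b × q ≡ a ℚ.- b
  ; upper = λ q → ∃₂ λ a b → [ x ]< a × b <[ y ] × q ≡ a ℚ.- b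
  }

-- If a < x < a′ and b < y < b′, then x y lies between the least and the
-- greatest of the four products of endpoints.
_*ᴿ_ : Cut → Cut → Cut
x *ᴿ y = record
  { lower = λ q → ∃₂ λ a a′ → ∃₂ λ b b′ → Encloses a a′ b b′ ×
              q ℚ.< ((a ℚ.* b) ⊓ (a ℚ.* b′)) ⊓ ((a′ ℚ.* b) ⊓ (a′ ℚ.* b′))
  ; upper = λ q → ∃₂ λ a a′ → ∃₂ λ b b′ → Encloses a a′ b b′ ×
              ((a ℚ.* b) ⊔ (a ℚ.* b′)) ⊔ ((a′ ℚ.* b) ⊔ (a′ ℚ.* b′)) ℚ.< q
  }
  where
  Encloses : ℚ → ℚ → ℚ → ℚ → Set
  Encloses a a′ b b′ = (a <[ x ] × [ x ]< a′) × (b <[ y ] × [ y ]< b′)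

-- Meaningful only for x > 0.
_⁻¹ : Cut → Cut
x ⁻¹ = record
  { lower = λ q → ∃[ r ] [ x ]< r × q ℚ.* r ℚ.< 1ℚ
  ; upper = λ q → ∃[ r ] r <[ x ] × 0ℚ ℚ.< r × 1ℚ ℚ.< q ℚ.* r
  }

-- Meaningful only for y > 0.
_/ᴿ_ : Cut → Cut → Cut
x /ᴿ y = x *ᴿ y ⁻¹

_^ℤ_ : (b : ℕ) .{{_ : NonZero b}} → ℤ → ℚ
b ^ℤ (+ p)    = fromℕ→ℚ (b ℕ.^ p)
b ^ℤ -[1+ p ] = (+ 1 ℚ./ (b ℕ.^ suc p)) {{ℕ.m^n≢0 b (suc p)}}

-- With r = p / d in lowest terms, b ^ r is the positive d-th root of b ^ p.
_^ᴿℚ_ : (b : ℕ) .{{_ : NonZero b}} → ℚ → Cut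
b ^ᴿℚ r = record
  { lower = λ q → q ℚ.< 0ℚ ⊎ q ^ℚ (↧ₙ r) ℚ.< b ^ℤ (↥ r)
  ; upper = λ q → 0ℚ ℚ.< q × b ^ℤ (↥ r) ℚ.< q ^ℚ (↧ₙ r)
  }

-- As b ≥ 1, the function r ↦ b ^ r is monotone, and b ^ x is the common value
-- of the supremum of b ^ r over r < x and the infimum over r > x.
infixr 8 _^ᴿ_
_^ᴿ_ : (b : ℕ) .{{_ : NonZero b}} → Cut → Cut
b ^ᴿ x = record
  { lower = λ q → ∃[ r ] r <[ x ] × q <[ b ^ᴿℚ r ]
  ; upper = λ q → ∃[ r ] [ x ]< r × [ b ^ᴿℚ r ]< q
  }

-- For a ≥ 1:  r < log₂ a  iff  2 ^ r < a.
log₂ : ℕ → Cut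
log₂ a = record
  { lower = λ r → [ 2 ^ᴿℚ r ]< fromℕ→ℚ a
  ; upper = λ r → fromℕ→ℚ a <[ 2 ^ᴿℚ r ]
  }

{-# OPTIONS --safe #-}
module Submission where

-- Let T be a P_k-free tournament, and let ε = 2 ^ (- O(k log² k)).  The heart of the proof is
-- that every set W of at least two vertices contains disjoint X, Y with |X|, |Y| ≥ ε |W|
-- and no edge from Y to X.  Colouring X ∪ Y with max(χ(X), χ(Y)) colours and the rest
-- recursively, this gives χ(T) ≤ n ^ (1 - δ) for δ = 1 / (2 log (1/ε)), by Bernoulli.
--
-- To find X and Y, embed P_k greedily into W, one vertex x at a time, keeping both
-- N⁻(x) and N⁺(x) large in the candidate set.  As T is P_k-free this fails, which yields
-- two sets of relative size k ^ (- O(k)) with almost all edges in one direction.  Iterating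
-- log k times inside both sets (Fox and Sudakov's argument) gives a sequence of more than k
-- sets with almost all edges forward.  Now P_k has an ordering v₂ v₁ v₄ v₃ v₆ v₅ ⋯ whose
-- backward edges form a matching, so P_k can be embedded along the sequence unless some
-- pair of large subsets spans no backward edge at all.

open import Defs
open import Level using (0ℓ)
open import Data.Bool.Base using (true; false)
open import Data.Empty using (⊥-elim)
open import Data.Fin.Base as Fin using (Fin; zero; suc; toℕ; fromℕ; fromℕ<; inject₁)
import Data.Fin.Properties as Fin
open import Data.Fin.Subset as Subset using (Subset)
open import Data.Integer.Base as ℤ using (-[1+_])
import Data.Integer.Properties as ℤ
open import Data.List.Base using (List; []; _∷_; _++_; length; filter; map; take; lookup; allFin)
import Data.List.Membership.DecPropositional as DecMembership
open import Data.List.Membership.Propositional using (_∈_; find)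
open import Data.List.Membership.Propositional.Properties using (∈-filter⁻; ∈-filter⁺; ∈-++⁺ˡ; ∈-++⁺ʳ; ∈-++⁻; ∈-lookup; ∈-allFin)
open import Data.List.Properties using (length-++; length-map; length-take; length-filter; length-tabulate; filter-all; filter-accept; filter-reject; filter-notAll; take++drop≡id)
open import Data.List.Relation.Binary.Disjoint.Propositional using (Disjoint)
open import Data.List.Relation.Binary.Subset.Propositional using (_⊆_)
open import Data.List.Relation.Binary.Subset.Propositional.Properties using (⊆-trans; filter-⊆)
open import Data.List.Relation.Unary.All as All using (All; []; _∷_)
import Data.List.Relation.Unary.All.Properties as All
open import Data.List.Relation.Unary.AllPairs as AllPairs using (AllPairs; []; _∷_)
import Data.List.Relation.Unary.AllPairs.Properties as AllPairs
open import Data.List.Relation.Unary.Any as Any using (Any; here; there)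
import Data.List.Relation.Unary.Any.Properties as Any
open import Data.List.Relation.Unary.Unique.Propositional using (Unique)
open import Data.List.Relation.Unary.Unique.Propositional.Properties as Unique using (Unique[x∷xs]⇒x∉xs)
open import Data.Nat.Base as ℕ using (ℕ; zero; suc; pred; _+_; _*_; _∸_; _^_; _⊔_; _⊓_; _≤_; _<_; z≤n; s≤s; NonZero; >-nonZero; >-nonZero⁻¹)
open import Data.Nat.Coprimality as Coprime using (1-coprimeTo)
open import Data.Nat.ListAction using (sum)
import Data.Nat.Properties as ℕ
open import Data.Nat.Properties
open import Data.Nat.Solver using () renaming (module +-*-Solver to ℕ-Solver)
open import Data.Product using (∃-syntax; _×_; _,_; proj₁; proj₂)
open import Data.Rational.Base as ℚ using (ℚ; mkℚ; 0ℚ; 1ℚ; ↥_; ↧ₙ_; *≤*; nonNegative)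
import Data.Rational.Properties as ℚ
open import Data.Rational.Solver using () renaming (module +-*-Solver to ℚ-Solver)
import Data.Rational.Unnormalised.Properties as ℚᵘ
open import Data.Sum.Base using (_⊎_; inj₁; inj₂)
open import Data.Vec.Base using (tabulate)
open import Data.Vec.Properties using (lookup∘tabulate; []=⇒lookup; lookup⇒[]=)
open import Data.Vec.Properties.WithK using ([]=-irrelevant)
open import Algebra.Definitions.RawSemiring ℚ.+-*-rawSemiring using () renaming (_^_ to _^ℚ_)
open import Function.Base using (_∘_; flip; id; it)
open import Function.Bundles using (mk⇔; mk↔ₛ′)
open import Relation.Binary.Core using (Rel)
open import Relation.Binary.Definitions using (Decidable; tri<; tri≈; tri>)
open import Relation.Binary.PropositionalEquality hiding ([_])
open import Relation.Nullary using (¬_; yes; no; does; contradiction)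
open import Relation.Nullary.Decidable using (¬?; _×-dec_; decidable-stable; dec-true)
import Relation.Unary as U

-- Power inequalities behind the recursive count of colours.

^-distribʳ-* : ∀ N a b → (a * b) ^ N ≡ a ^ N * b ^ N
^-distribʳ-* zero    a b = refl
^-distribʳ-* (suc N) a b = trans (cong (a * b *_) (^-distribʳ-* N a b)) (*-interchange a b (a ^ N) (b ^ N))
  where
  *-interchange : ∀ w x y z → w * x * (y * z) ≡ w * y * (x * z)
  *-interchange = solve 4 (λ w x y z → w :* x :* (y :* z) := w :* y :* (x :* z)) refl
    where open ℕ-Solver

^-cancelʳ-≤ : ∀ N .{{_ : NonZero N}} a b → a ^ N ≤ b ^ N → a ≤ b
^-cancelʳ-≤ N a b aᴺ≤bᴺ with a ≤? b
... | yes a≤b = a≤b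
... | no  a≰b = ⊥-elim (<⇒≱ (^-monoˡ-< N (≰⇒> a≰b)) aᴺ≤bᴺ)

-- Bernoulli's inequality for (1 + d/p)^(N+1), cleared of denominators.
bernoulli : ∀ p d N → p ^ suc N + suc N * (p ^ N * d) ≤ (p + d) ^ suc N
bernoulli p d zero = ≤-reflexive
  (solve 2 (λ p d → p :* con 1 :+ (con 1 :* d :+ con 0) := (p :+ d) :* con 1) refl p d)
  where open ℕ-Solver
bernoulli p d (suc N) = begin
  p * (p * x) + suc (suc N) * ((p * x) * d)
    ≤⟨ m≤m+n _ (suc N * (x * d) * d) ⟩
  p * (p * x) + suc (suc N) * ((p * x) * d) + suc N * (x * d) * d
    ≡⟨ solve 4 (λ p d x N →
         p :* (p :* x) :+ (con 2 :+ N) :* ((p :* x) :* d) :+ (con 1 :+ N) :* (x :* d) :* d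
         := (p :+ d) :* (p :* x :+ (con 1 :+ N) :* (x :* d))) refl p d x N ⟩
  (p + d) * (p * x + suc N * (x * d))
    ≤⟨ *-monoʳ-≤ (p + d) (bernoulli p d N) ⟩
  (p + d) * (p + d) ^ suc N ∎
  where
  open ≤-Reasoning
  open ℕ-Solver
  x : ℕ
  x = p ^ N

-- Holds since 8 ≤ 9. In `power-sum` it absorbs the factor `2 ^ e` into (3/2)^(2e), which is where
-- the 3/2 there comes from.
8^n≤9^n : ∀ e → 2 ^ e * 2 ^ (e + e) ≤ 3 ^ (e + e)
8^n≤9^n e = begin
  2 ^ e * 2 ^ (e + e)       ≡⟨ cong (2 ^ e *_) (^-distribˡ-+-* 2 e e) ⟩
  2 ^ e * (2 ^ e * 2 ^ e)   ≡⟨ cong (2 ^ e *_) (^-distribʳ-* e 2 2) ⟨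
  2 ^ e * 4 ^ e             ≡⟨ ^-distribʳ-* e 2 4 ⟨
  8 ^ e                     ≤⟨ ^-monoˡ-≤ e (n≤1+n 8) ⟩
  9 ^ e                     ≡⟨ ^-distribʳ-* e 3 3 ⟩
  3 ^ e * 3 ^ e             ≡⟨ ^-distribˡ-+-* 3 e e ⟨
  3 ^ (e + e)               ∎
  where open ≤-Reasoning

-- If t = a + b satisfies t ^ (N + 1) ≥ n ^ N, the hypothesis on a gives a / t ≤ 3m / 2n, hence
-- b / t ≥ 1 - 3m / 2n, and Bernoulli gives (1 - 3m / 2n) ^ (N + 1) ≥ (1 - 2m / n) ^ N.
power-sum : ∀ e a b m r N → e + e ≡ suc N → 3 ≤ N →
            let n = m + m + r in
            n ≤ m * 2 ^ e → a ^ suc N ≤ m ^ N → b ^ suc N ≤ r ^ N → (a + b) ^ suc N ≤ n ^ N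
power-sum e a zero m r N _ _ _ a≤ _ = begin
  (a + 0) ^ suc N  ≡⟨ cong (_^ suc N) (+-identityʳ a) ⟩
  a ^ suc N        ≤⟨ a≤ ⟩
  m ^ N            ≤⟨ ^-monoˡ-≤ N (≤-trans (m≤m+n m m) (m≤m+n (m + m) r)) ⟩
  (m + m + r) ^ N  ∎
  where open ≤-Reasoning
-- As N is positive, 0 ^ N = 0, so a nonzero `b` contradicts its bound.
power-sum e a (suc b) m zero (suc N) _ _ _ _ b≤ = ⊥-elim (<⇒≱ (m^n>0 (suc b) (2 + N)) b≤)
power-sum e a b@(suc _) m r@(suc _) N eq 3≤N n≤ a≤ b≤ with ≤-total ((a + b) ^ suc N) ((m + m + r) ^ N)
... | inj₁ le = le
... | inj₂ ge = *-cancelˡ-≤ (2 ^ suc N * (r ^ N * n)) {{nz}} main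
  where
  open ≤-Reasoning
  open ℕ-Solver
  t n : ℕ
  t = a + b
  n = m + m + r
  nz : NonZero (2 ^ suc N * (r ^ N * n))
  nz = m*n≢0 (2 ^ suc N) (r ^ N * n) {{m^n≢0 2 (suc N)}}
         {{m*n≢0 (r ^ N) n {{m^n≢0 r N}} {{>-nonZero (≤-trans (s≤s z≤n) (m≤n+m r (m + m)))}}}}

  -- One factor n is bounded by m 2^e, the other N by `ge`; then 2^e 2^(N+1) ≤ 3^(N+1) because N + 1
  -- = 2e.
  a-small : 2 * a * n ≤ 3 * m * t
  a-small = ^-cancelʳ-≤ (suc N) (2 * a * n) (3 * m * t) (begin
    (2 * a * n) ^ suc N
      ≡⟨ trans (^-distribʳ-* (suc N) (2 * a) n) (cong (_* n ^ suc N) (^-distribʳ-* (suc N) 2 a)) ⟩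
    2 ^ suc N * a ^ suc N * (n * n ^ N)
      ≤⟨ *-mono-≤ (*-monoʳ-≤ (2 ^ suc N) a≤) (*-mono-≤ n≤ ge) ⟩
    2 ^ suc N * m ^ N * (m * 2 ^ e * t ^ suc N)
      ≡⟨ solve 5 (λ x y m z t → x :* y :* (m :* z :* t) := (z :* x) :* (m :* y) :* t)
           refl (2 ^ suc N) (m ^ N) m (2 ^ e) (t ^ suc N) ⟩
    2 ^ e * 2 ^ suc N * m ^ suc N * t ^ suc N
      ≤⟨ *-monoˡ-≤ (t ^ suc N) (*-monoˡ-≤ (m ^ suc N)
           (subst (λ s → 2 ^ e * 2 ^ s ≤ 3 ^ s) eq (8^n≤9^n e))) ⟩
    3 ^ suc N * m ^ suc N * t ^ suc N
      ≡⟨ trans (^-distribʳ-* (suc N) (3 * m) t) (cong (_* t ^ suc N) (^-distribʳ-* (suc N) 3 m)) ⟨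
    (3 * m * t) ^ suc N ∎)

  b-large : t * (2 * r + m) ≤ 2 * (b * n)
  b-large = +-cancelˡ-≤ (2 * a * n) _ _ (begin
    2 * a * n + t * (2 * r + m)  ≤⟨ +-monoˡ-≤ _ a-small ⟩
    3 * m * t + t * (2 * r + m)
      ≡⟨ solve 4 (λ a b m r →
           con 3 :* m :* (a :+ b) :+ (a :+ b) :* (con 2 :* r :+ m)
           := con 2 :* a :* (m :+ m :+ r) :+ con 2 :* (b :* (m :+ m :+ r))) refl a b m r ⟩
    2 * a * n + 2 * (b * n) ∎)

  -- Bernoulli with p = 2r and d = m. The left side is (2r)^(N+1) + 4 m (2r)^N, so N + 1 has to be
  -- at least 4.
  step : 2 ^ suc N * (r ^ N * n) ≤ (2 * r + m) ^ suc N
  step = begin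
    2 ^ suc N * (r ^ N * n)
      ≡⟨ solve 4 (λ x y m r → con 2 :* x :* (y :* (m :+ m :+ r))
           := con 2 :* r :* (x :* y) :+ con 4 :* (x :* y :* m)) refl (2 ^ N) (r ^ N) m r ⟩
    2 * r * (2 ^ N * r ^ N) + 4 * (2 ^ N * r ^ N * m)
      ≡⟨ cong (λ z → 2 * r * z + 4 * (z * m)) (^-distribʳ-* N 2 r) ⟨
    (2 * r) ^ suc N + 4 * ((2 * r) ^ N * m)
      ≤⟨ +-monoʳ-≤ ((2 * r) ^ suc N) (*-monoˡ-≤ ((2 * r) ^ N * m) (s≤s 3≤N)) ⟩
    (2 * r) ^ suc N + suc N * ((2 * r) ^ N * m)
      ≤⟨ bernoulli (2 * r) m N ⟩
    (2 * r + m) ^ suc N ∎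

  main : 2 ^ suc N * (r ^ N * n) * t ^ suc N ≤ 2 ^ suc N * (r ^ N * n) * n ^ N
  main = begin
    2 ^ suc N * (r ^ N * n) * t ^ suc N     ≤⟨ *-monoˡ-≤ (t ^ suc N) step ⟩
    (2 * r + m) ^ suc N * t ^ suc N         ≡⟨ *-comm ((2 * r + m) ^ suc N) (t ^ suc N) ⟩
    t ^ suc N * (2 * r + m) ^ suc N         ≡⟨ ^-distribʳ-* (suc N) t (2 * r + m) ⟨
    (t * (2 * r + m)) ^ suc N               ≤⟨ ^-monoˡ-≤ (suc N) b-large ⟩
    (2 * (b * n)) ^ suc N
      ≡⟨ trans (^-distribʳ-* (suc N) 2 (b * n)) (cong (2 ^ suc N *_) (^-distribʳ-* (suc N) b n)) ⟩
    2 ^ suc N * (b ^ suc N * n ^ suc N)     ≤⟨ *-monoʳ-≤ (2 ^ suc N) (*-monoˡ-≤ (n ^ suc N) b≤) ⟩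
    2 ^ suc N * (r ^ N * n ^ suc N)
      ≡⟨ solve 4 (λ x y n z → x :* (y :* (n :* z)) := x :* (y :* n) :* z) refl (2 ^ suc N) (r ^ N) n (n ^ N) ⟩
    2 ^ suc N * (r ^ N * n) * n ^ N ∎

binary-log : ∀ k → 1 ≤ k → ∃[ L ] 2 ^ L ≤ k × k < 2 ^ suc L
binary-log (suc zero) _ = 0 , ≤-refl , ≤-refl
binary-log (suc k@(suc _)) _ with binary-log k (s≤s z≤n)
... | L , lo , hi with suc k <? 2 ^ suc L
...   | yes hi′ = L , m≤n⇒m≤1+n lo , hi′
...   | no  k≮  = suc L , ≮⇒≥ k≮ ,
    ≤-trans (s≤s hi) (subst (suc (2 ^ suc L) ≤_) (cong ((2 ^ suc L) +_) (sym (+-identityʳ (2 ^ suc L))))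
      (+-monoˡ-≤ (2 ^ suc L) (m^n>0 2 (suc L))))

-- Counting in lists: double counting, Markov's inequality and union bounds.

module _ {A : Set} {P : A → Set} (P? : U.Decidable P) where

  count : List A → ℕ
  count xs = length (filter P? xs)

  count-filter-≤ : {Q : A → Set} (Q? : U.Decidable Q) → ∀ xs → count (filter Q? xs) ≤ count xs
  count-filter-≤ Q? []       = z≤n
  count-filter-≤ Q? (x ∷ xs) with does (Q? x)
  ... | true with does (P? x)
  ...   | true  = s≤s (count-filter-≤ Q? xs)
  ...   | false = count-filter-≤ Q? xs
  count-filter-≤ Q? (x ∷ xs) | false with does (P? x)
  ...   | true  = m≤n⇒m≤1+n (count-filter-≤ Q? xs)
  ...   | false = count-filter-≤ Q? xs

  count-cover : {Q : A → Set} (Q? : U.Decidable Q) → ∀ xs → (∀ {x} → x ∈ xs → ¬ Q x → P x) →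
                length xs ≤ length (filter Q? xs) + count xs
  count-cover Q? []       _ = z≤n
  count-cover Q? (x ∷ xs) h with P? x | Q? x
  ... | yes _  | yes _  = s≤s (≤-trans (count-cover Q? xs (h ∘ there)) (+-monoʳ-≤ _ (n≤1+n _)))
  ... | no _   | yes _  = s≤s (count-cover Q? xs (h ∘ there))
  ... | yes _  | no _   = ≤-trans (s≤s (count-cover Q? xs (h ∘ there))) (≤-reflexive (sym (+-suc _ _)))
  ... | no ¬Px | no ¬Qx = contradiction (h (here refl) ¬Qx) ¬Px

module _ {A : Set} {R : Rel A 0ℓ} (R? : Decidable R) where

  edges : List A → List A → ℕ
  edges xs ys = sum (map (λ x → count (R? x) ys) xs)

  -- `edges` counts by rows; peeling off a column lets `heavy-edges` count the same pairs from the
  -- side of `ys`.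
  edges-∷ʳ : ∀ y xs ys → edges xs (y ∷ ys) ≡ count (flip R? y) xs + edges xs ys
  edges-∷ʳ y []       ys = refl
  edges-∷ʳ y (x ∷ xs) ys with does (R? x y)
  ... | true  = cong suc (trans (cong ((count (R? x) ys) +_) (edges-∷ʳ y xs ys))
                  (solve 3 (λ a b c → a :+ (b :+ c) := b :+ (a :+ c)) refl
                    (count (R? x) ys) (count (flip R? y) xs) (edges xs ys)))
    where open ℕ-Solver
  ... | false = trans (cong ((count (R? x) ys) +_) (edges-∷ʳ y xs ys))
                  (solve 3 (λ a b c → a :+ (b :+ c) := b :+ (a :+ c)) refl
                    (count (R? x) ys) (count (flip R? y) xs) (edges xs ys))
    where open ℕ-Solver

  edges-≤ : ∀ C D xs ys → (∀ {x} → x ∈ xs → C * count (R? x) ys ≤ D) → C * edges xs ys ≤ length xs * D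
  edges-≤ C D []       ys _ = ≤-reflexive (*-zeroʳ C)
  edges-≤ C D (x ∷ xs) ys h = ≤-trans (≤-reflexive (*-distribˡ-+ C (count (R? x) ys) (edges xs ys)))
    (+-mono-≤ (h (here refl)) (edges-≤ C D xs ys (h ∘ there)))

  Heavy? : ∀ F a xs → U.Decidable (λ y → ¬ F * count (flip R? y) xs ≤ a)
  Heavy? F a xs y = ¬? (F * count (flip R? y) xs ≤? a)

  heavy-edges : ∀ F a xs ys → count (Heavy? F a xs) ys * a ≤ F * edges xs ys
  heavy-edges F a xs []       = z≤n
  heavy-edges F a xs (y ∷ ys) = ≤-trans step
    (≤-reflexive (sym (trans (cong (F *_) (edges-∷ʳ y xs ys)) (*-distribˡ-+ F (count (flip R? y) xs) _))))
    where
    step : count (Heavy? F a xs) (y ∷ ys) * a ≤ F * count (flip R? y) xs + F * edges xs ys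
    step with F * count (flip R? y) xs ≤? a
    ... | yes ≤a rewrite filter-reject (Heavy? F a xs) {xs = ys} (λ ≰a → ≰a ≤a) =
      ≤-trans (heavy-edges F a xs ys) (m≤n+m _ _)
    ... | no ≰a rewrite filter-accept (Heavy? F a xs) {xs = ys} ≰a =
      +-mono-≤ (<⇒≤ (≰⇒> ≰a)) (heavy-edges F a xs ys)

  -- Markov's inequality: there are at most a D / C related pairs, and each heavy element of `ys`
  -- accounts for more than a / F of them.
  few-heavy : ∀ C D F a .{{_ : NonZero a}} xs ys → length xs ≤ a →
              (∀ {x} → x ∈ xs → C * count (R? x) ys ≤ D) → C * count (Heavy? F a xs) ys ≤ F * D
  few-heavy C D F a xs ys xs≤a h = *-cancelʳ-≤ _ _ a (begin
    C * β * a              ≡⟨ *-assoc C β a ⟩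
    C * (β * a)            ≤⟨ *-monoʳ-≤ C (heavy-edges F a xs ys) ⟩
    C * (F * edges xs ys)  ≡⟨ solve 3 (λ c f e → c :* (f :* e) := f :* (c :* e)) refl C F (edges xs ys) ⟩
    F * (C * edges xs ys)  ≤⟨ *-monoʳ-≤ F (≤-trans (edges-≤ C D xs ys h) (*-monoˡ-≤ D xs≤a)) ⟩
    F * (a * D)            ≡⟨ solve 3 (λ f a d → f :* (a :* d) := f :* d :* a) refl F a D ⟩
    F * D * a              ∎)
    where
    open ≤-Reasoning
    open ℕ-Solver
    β : ℕ
    β = count (Heavy? F a xs) ys

module _ {A B : Set} {Bad : B → A → Set} (Bad? : ∀ b → U.Decidable (Bad b)) where

  Clean? : (bs : List B) → U.Decidable (λ x → All (λ b → ¬ Bad b x) bs)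
  Clean? bs x = All.all? (λ b → ¬? (Bad? b x)) bs

  -- Union bound: each `b` spoils at most D / C of the elements.
  clean-large : ∀ C D zs bs → All (λ b → C * count (Bad? b) zs ≤ D) bs →
                C * length zs ≤ C * length (filter (Clean? bs) zs) + length bs * D
  clean-large C D zs [] [] = ≤-trans
    (*-monoʳ-≤ C (≤-reflexive (cong length (sym (filter-all (Clean? []) (All.universal (λ _ → []) zs))))))
    (m≤m+n _ _)
  clean-large C D zs (b ∷ bs) (h ∷ hs) = begin
    C * length zs                            ≤⟨ clean-large C D zs bs hs ⟩
    C * length zs₁ + length bs * D           ≤⟨ +-monoˡ-≤ _ (*-monoʳ-≤ C (split zs)) ⟩
    C * (length zs₂ + count (Bad? b) zs) + length bs * D
      ≡⟨ cong (_+ length bs * D) (*-distribˡ-+ C (length zs₂) (count (Bad? b) zs)) ⟩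
    C * length zs₂ + C * count (Bad? b) zs + length bs * D
      ≤⟨ +-monoˡ-≤ _ (+-monoʳ-≤ (C * length zs₂) h) ⟩
    C * length zs₂ + D + length bs * D       ≡⟨ +-assoc (C * length zs₂) D _ ⟩
    C * length zs₂ + (D + length bs * D)     ∎
    where
    open ≤-Reasoning
    zs₁ zs₂ : List A
    zs₁ = filter (Clean? bs) zs
    zs₂ = filter (Clean? (b ∷ bs)) zs
    split : ∀ zs → length (filter (Clean? bs) zs) ≤ length (filter (Clean? (b ∷ bs)) zs) + count (Bad? b) zs
    split [] = z≤n
    split (z ∷ zs) with Bad? b z | Clean? bs z
    ... | yes _ | yes _ = ≤-trans (s≤s (split zs)) (≤-reflexive (sym (+-suc _ _)))
    ... | yes _ | no _  = ≤-trans (split zs) (+-monoʳ-≤ _ (n≤1+n _))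
    ... | no _  | yes _ = s≤s (split zs)
    ... | no _  | no _  = split zs

  -- By the union bound the spoiled fraction is at most length bs * D / C, which is at most 1/2.
  half-clean : ∀ C D zs bs .{{_ : NonZero C}} → All (λ b → C * count (Bad? b) zs ≤ D * length zs) bs →
               2 * (length bs * D) ≤ C → length zs ≤ 2 * length (filter (Clean? bs) zs)
  half-clean C D zs bs h le = *-cancelˡ-≤ C (+-cancelʳ-≤ (C * z) _ _ (begin
    C * z + C * z
      ≤⟨ +-mono-≤ large large ⟩
    C * y + b * (D * z) + (C * y + b * (D * z))
      ≡⟨ solve 5 (λ C y b D z → C :* y :+ b :* (D :* z) :+ (C :* y :+ b :* (D :* z))
           := C :* (con 2 :* y) :+ con 2 :* (b :* D) :* z) refl C y b D z ⟩
    C * (2 * y) + 2 * (b * D) * z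
      ≤⟨ +-monoʳ-≤ (C * (2 * y)) (*-monoˡ-≤ z le) ⟩
    C * (2 * y) + C * z ∎))
    where
    open ≤-Reasoning
    open ℕ-Solver
    z y b : ℕ
    z = length zs
    y = length (filter (Clean? bs) zs)
    b = length bs
    large : C * z ≤ C * y + b * (D * z)
    large = clean-large C (D * z) zs bs h

-- The elements are dealt alternately: exchanging the two hands after each one keeps their sizes
-- within one of each other.
halve : {A : Set} (zs : List A) → Unique zs → ∃[ xs ] ∃[ ys ]
        Unique xs × Unique ys × xs ⊆ zs × ys ⊆ zs × Disjoint xs ys ×
        length ys ≤ length xs × length xs ≤ suc (length ys) × length zs ≡ length xs + length ys
halve []       []         = [] , [] , [] , [] , id , id , (λ ()) , z≤n , z≤n , refl
halve (z ∷ zs) z!@(z∉ ∷ zs!) with halve zs zs!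
... | xs , ys , xs! , ys! , xs⊆ , ys⊆ , disj , y≤x , x≤y , eq =
  z ∷ ys , xs , All.tabulate (λ p z≡ → z∉zs (subst (_∈ zs) (sym z≡) (ys⊆ p))) ∷ ys! , xs! ,
  (λ { (here p) → here p ; (there p) → there (ys⊆ p) }) , there ∘ xs⊆ ,
  (λ { (here refl , q) → z∉zs (xs⊆ q) ; (there p , q) → disj (q , p) }) ,
  x≤y , s≤s y≤x , cong suc (trans eq (+-comm (length xs) (length ys)))
  where
  z∉zs : ¬ z ∈ zs
  z∉zs = Unique[x∷xs]⇒x∉xs z!

-- Induced paths, and sparse pairs from greedy embedding.

module _ {n : ℕ} (T : Digraph (Fin n)) where
  open Digraph T

  -- InducedPath (v₁ ∷ v₂ ∷ ⋯) says that v₁, v₂, ⋯ induce the tournament P_k in this order.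
  data InducedPath : List (Fin n) → Set where
    []   : InducedPath []
    [-]  : ∀ {x} → InducedPath (x ∷ [])
    cons : ∀ {x y zs} → E y x → All (E x) zs → InducedPath (y ∷ zs) → InducedPath (x ∷ y ∷ zs)

  take-path : ∀ r {xs} → InducedPath xs → InducedPath (take r xs)
  take-path zero          _            = []
  take-path (suc r)       []           = []
  take-path (suc r)       [-]          with r
  ... | zero  = [-]
  ... | suc _ = [-]
  take-path (suc zero)    (cons _ _ _) = [-]
  take-path (suc (suc r)) (cons e a p) = cons e (All.take⁺ r a) (take-path (suc r) p)

  -- `1 / G` is the relative size and `1 / M` the density of the rare direction, which `sparse`
  -- leaves open. Only degrees of vertices of `X` are controlled; `Combine` recovers control from
  -- the side of `Y` by averaging.
  record SparsePair (M G : ℕ) (W : List (Fin n)) : Set where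
    field
      X Y      : List (Fin n)
      X!       : Unique X
      Y!       : Unique Y
      X⊆W      : X ⊆ W
      Y⊆W      : Y ⊆ W
      disjoint : Disjoint X Y
      X-large  : length W ≤ G * length X
      Y-large  : length W ≤ G * length Y
      sparse   : (∀ {x} → x ∈ X → M * count (λ y → E? y x) Y ≤ length Y)
               ⊎ (∀ {x} → x ∈ X → M * count (E? x) Y ≤ length Y)

  record PurePair (G : ℕ) (W : List (Fin n)) : Set where
    field
      X Y      : List (Fin n)
      X!       : Unique X
      Y!       : Unique Y
      X⊆W      : X ⊆ W
      Y⊆W      : Y ⊆ W
      disjoint : Disjoint X Y
      X-large  : length W ≤ G * length X
      Y-large  : length W ≤ G * length Y
      pure     : ∀ {x y} → x ∈ X → y ∈ Y → ¬ E y x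

  module _ (tournament : IsTournament T) where

    total : ∀ {u v} → u ≢ v → ¬ E u v → E v u
    total {u} {v} u≢v ¬uv with tournament u v u≢v
    ... | inj₁ (uv , _) = contradiction uv ¬uv
    ... | inj₂ (vu , _) = vu

    asym : ∀ {u v} → E u v → ¬ E v u
    asym {u} {v} uv vu with tournament u v (λ { refl → irrefl u uv })
    ... | inj₁ (_ , ¬vu) = ¬vu vu
    ... | inj₂ (_ , ¬uv) = ¬uv uv

    -- One vertex x of the path is fixed at a time: its successor is sought in
    -- N⁻(x) ∩ Y and everything beyond the successor in N⁺(x) ∩ Y.
    grow : ∀ M .{{_ : NonZero M}} W r G X Y → Unique X → Unique Y → X ⊆ W → Y ⊆ W → Disjoint X Y →
           0 < length X → length W ≤ G * length X → length W ≤ G * length Y →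
           (∃[ x ] ∃[ xs ] InducedPath (x ∷ xs) × length xs ≡ r × x ∈ X × All (_∈ Y) xs)
           ⊎ SparsePair M (2 * (G * M ^ r)) W
    grow M W zero G (x ∷ X) Y _ _ _ _ _ _ _ _ = inj₁ (x , [] , [-] , refl , here refl , [])
    grow M W (suc r) G X Y X! Y! X⊆W Y⊆W disj _ W≤X W≤Y
      with Any.any? (λ x → ¬? (M * count (λ y → E? y x) Y ≤? length Y) ×-dec
                           ¬? (M * count (E? x) Y ≤? length Y)) X
    ... | yes found = extend (find found)
      where
      extend : (∃[ x ] x ∈ X × ¬ (M * count (λ y → E? y x) Y ≤ length Y) × ¬ (M * count (E? x) Y ≤ length Y)) →
               (∃[ x ] ∃[ xs ] InducedPath (x ∷ xs) × length xs ≡ suc r × x ∈ X × All (_∈ Y) xs)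
               ⊎ SparsePair M (2 * (G * M ^ suc r)) W
      extend (x , x∈X , in-large , out-large)
        -- The in-neighbours become the candidates for the next vertex and the out-neighbours those
        -- for all later ones. Each keeps more than a fraction `1 / M` of `Y`, so `G` grows to
        -- `G * M`.
        with grow M W r (G * M) (filter (λ y → E? y x) Y) (filter (E? x) Y)
               (Unique.filter⁺ _ Y!) (Unique.filter⁺ _ Y!) (⊆-trans (filter-⊆ _ Y) Y⊆W) (⊆-trans (filter-⊆ _ Y) Y⊆W)
               (λ (p , q) → asym (proj₂ (∈-filter⁻ (λ y → E? y x) {xs = Y} p)) (proj₂ (∈-filter⁻ (E? x) {xs = Y} q)))
               positive (enlarge in-large) (enlarge out-large)
        where
        positive : 0 < count (λ y → E? y x) Y
        positive = n≢0⇒n>0 (λ eq → in-large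
          (subst (λ c → M * c ≤ length Y) (sym eq) (≤-trans (≤-reflexive (*-zeroʳ M)) z≤n)))
        enlarge : ∀ {c} → ¬ (M * c ≤ length Y) → length W ≤ G * M * c
        enlarge {c} large = ≤-trans W≤Y (≤-trans (*-monoʳ-≤ G (<⇒≤ (≰⇒> large))) (≤-reflexive (sym (*-assoc G M c))))
      ... | inj₂ pair = inj₂ (subst (λ c → SparsePair M (2 * c) W) (*-assoc G M (M ^ r)) pair)
      ... | inj₁ (y , ys , path , len , y∈ , ys∈) =
        let (y∈Y , yx) = ∈-filter⁻ (λ y → E? y x) {xs = Y} y∈
            ys∈′       = All.map (∈-filter⁻ (E? x) {xs = Y}) ys∈
        in inj₁ (x , y ∷ ys , cons yx (All.map proj₂ ys∈′) path , cong suc len , x∈X , y∈Y ∷ All.map proj₁ ys∈′)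
    -- Every x in `X` now has few in-neighbours or few out-neighbours in `Y`. The commoner kind
    -- makes up half of `X`, whence the factor 2.
    ... | no none = inj₂ (result (≤-total (length X₂) (length X₁)))
      where
      In? : U.Decidable (λ x → M * count (λ y → E? y x) Y ≤ length Y)
      In? x = M * count (λ y → E? y x) Y ≤? length Y
      Out? : U.Decidable (λ x → M * count (E? x) Y ≤ length Y)
      Out? x = M * count (E? x) Y ≤? length Y
      X₁ X₂ : List (Fin n)
      X₁ = filter In? X
      X₂ = filter Out? X
      X≤ : length X ≤ length X₁ + length X₂
      X≤ = count-cover Out? In? X (λ {x} x∈X ¬in → decidable-stable (Out? x)
             (λ ¬out → none (Any.map (λ { refl → ¬in , ¬out }) x∈X)))
      G≤ : G ≤ G * M ^ suc r
      G≤ = m≤m*n G (M ^ suc r) {{m^n≢0 M (suc r)}}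
      half : ∀ {c d} → c ≤ d → length X ≤ d + c → length W ≤ 2 * (G * M ^ suc r) * d
      half {c} {d} c≤d X≤ = begin
        length W                    ≤⟨ W≤X ⟩
        G * length X                ≤⟨ *-mono-≤ G≤ (≤-trans X≤ (+-monoʳ-≤ d c≤d)) ⟩
        G * M ^ suc r * (d + d)     ≡⟨ solve 2 (λ g d → g :* (d :+ d) := con 2 :* g :* d) refl (G * M ^ suc r) d ⟩
        2 * (G * M ^ suc r) * d     ∎
        where
        open ≤-Reasoning
        open ℕ-Solver
      Y-large : length W ≤ 2 * (G * M ^ suc r) * length Y
      Y-large = ≤-trans W≤Y (*-monoˡ-≤ (length Y) (≤-trans G≤ (m≤m+n _ _)))
      result : length X₂ ≤ length X₁ ⊎ length X₁ ≤ length X₂ → SparsePair M (2 * (G * M ^ suc r)) W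
      result (inj₁ le) = record
        { X = X₁ ; Y = Y ; X! = Unique.filter⁺ In? X! ; Y! = Y!
        ; X⊆W = ⊆-trans (filter-⊆ In? X) X⊆W ; Y⊆W = Y⊆W
        ; disjoint = λ (p , q) → disj (filter-⊆ In? X p , q)
        ; X-large = half le X≤ ; Y-large = Y-large
        ; sparse = inj₁ (proj₂ ∘ ∈-filter⁻ In? {xs = X}) }
      result (inj₂ le) = record
        { X = X₂ ; Y = Y ; X! = Unique.filter⁺ Out? X! ; Y! = Y!
        ; X⊆W = ⊆-trans (filter-⊆ Out? X) X⊆W ; Y⊆W = Y⊆W
        ; disjoint = λ (p , q) → disj (filter-⊆ Out? X p , q)
        ; X-large = half le (≤-trans X≤ (≤-reflexive (+-comm (length X₁) (length X₂)))) ; Y-large = Y-large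
        ; sparse = inj₂ (proj₂ ∘ ∈-filter⁻ Out? {xs = X}) }

    -- The greedy embedding starts from two halves of `W`. As the smaller half is nonempty, length W
    -- ≤ 2 |Y| + 1 ≤ 4 |Y|, so the search begins with `G` = 4, a power of two.
    sparse-pair : ∀ M .{{_ : NonZero M}} r W → Unique W → 2 ≤ length W →
                  (∀ {xs} → InducedPath xs → ¬ suc r ≤ length xs) → SparsePair M (2 * (4 * M ^ r)) W
    sparse-pair M r W W! 2≤W no-path with halve W W!
    ... | X , Y , X! , Y! , X⊆W , Y⊆W , disj , Y≤X , X≤Y , eq
      with grow M W r 4 X Y X! Y! X⊆W Y⊆W disj (≤-trans 1≤Y Y≤X) (≤-trans W≤4Y (*-monoʳ-≤ 4 Y≤X)) W≤4Y
      where
      1≤Y : 1 ≤ length Y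
      1≤Y = n≢0⇒n>0 (λ Y≡0 → <⇒≱ 2≤W (≤-trans (≤-reflexive eq)
              (subst (λ y → length X + y ≤ 1) (sym Y≡0)
                (≤-trans (≤-reflexive (+-identityʳ _)) (subst (λ y → length X ≤ suc y) Y≡0 X≤Y)))))
      W≤4Y : length W ≤ 4 * length Y
      W≤4Y = begin
        length W                          ≡⟨ eq ⟩
        length X + length Y               ≤⟨ +-monoˡ-≤ _ (≤-trans X≤Y (+-monoˡ-≤ (length Y) 1≤Y)) ⟩
        length Y + length Y + length Y    ≤⟨ m≤m+n _ (length Y) ⟩
        length Y + length Y + length Y + length Y
          ≡⟨ solve 1 (λ y → y :+ y :+ y :+ y := con 4 :* y) refl (length Y) ⟩
        4 * length Y                      ∎
        where
        open ≤-Reasoning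
        open ℕ-Solver
    ...   | inj₂ pair = pair
    ...   | inj₁ (_ , _ , path , len , _) = contradiction (≤-reflexive (cong suc (sym len))) (no-path path)

-- From sparse pairs to a sequence of sets with almost all edges forward.

-- An entry (A , a) is a vertex set together with the size that A had when it was
-- created; A may shrink later, and degrees into A are measured against a.
Entry : ℕ → Set
Entry n = List (Fin n) × ℕ

restrict : ∀ {n} {P : Fin n → Set} → U.Decidable P → Entry n → Entry n
restrict P? (A , a) = filter P? A , a

-- Two rounds of averaging make a sparse pair sparse between all pieces of its sides. `Column`
-- discards the vertices of `Y` heavy towards some piece of `X`, weakening `M` to `K`; `Row`
-- discards the vertices of `X` heavy towards some piece of the remaining `Y′`, weakening `K` to
-- `K′`.
module Combine {n : ℕ} {R : Rel (Fin n) 0ℓ} (R? : Decidable R) (K K′ M h : ℕ)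
  .{{_ : NonZero K}} .{{_ : NonZero M}}
  (K-large : 2 * (2 ^ h * (K′ * 2 ^ h)) ≤ K) (M-large : 2 * (2 ^ h * K) ≤ M)
  {X Y : List (Fin n)} (sparse : ∀ {x} → x ∈ X → M * count (R? x) Y ≤ length Y) where

  Sized : Entry n → Set
  Sized (A , a) = 0 < length A × length A ≤ a × a ≤ 2 ^ h * length A

  module Column (LX : List (Entry n)) (LX-sized : All (λ e → proj₁ e ⊆ X × Sized e) LX) (lenX : length LX ≡ 2 ^ h) where

    Light? : U.Decidable _
    Light? = Clean? (λ (A , a) → Heavy? R? K a A) LX

    Y′ : List (Fin n)
    Y′ = filter Light? Y

    Y′-large : length Y ≤ 2 * length Y′
    Y′-large = half-clean (λ (A , a) → Heavy? R? K a A) M K Y LX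
      (All.map (λ { {A , a} (A⊆X , 0<A , A≤a , _) →
        few-heavy R? M (length Y) K a {{>-nonZero (≤-trans 0<A A≤a)}} A Y A≤a (sparse ∘ A⊆X) }) LX-sized)
      (≤-trans (≤-reflexive (cong (λ l → 2 * (l * K)) lenX)) M-large)

    light : ∀ {A a y} → (A , a) ∈ LX → y ∈ Y′ → K * count (flip R? y) A ≤ a
    light {A} {a} {y} e∈ y∈ = decidable-stable (K * count (flip R? y) A ≤? a)
      (All.lookup (proj₂ (∈-filter⁻ Light? {xs = Y} y∈)) e∈)

    module Row (LY : List (Entry n)) (LY-sized : All (λ e → proj₁ e ⊆ Y′ × Sized e) LY) (lenY : length LY ≡ 2 ^ h) where

      Light′? : U.Decidable _
      Light′? = Clean? (λ (B , b) → Heavy? (flip R?) K′ b B) LY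

      trim : Entry n → Entry n
      trim = restrict Light′?

      trim-large : ∀ {A a} → (A , a) ∈ LX → length A ≤ 2 * length (filter Light′? A)
      trim-large {A} {a} e∈ = half-clean (λ (B , b) → Heavy? (flip R?) K′ b B) K (K′ * 2 ^ h) A LY
        (All.map (λ { {B , b} (B⊆Y′ , 0<B , B≤b , _) →
          ≤-trans (few-heavy (flip R?) K a K′ b {{>-nonZero (≤-trans 0<B B≤b)}} B A B≤b (light e∈ ∘ B⊆Y′))
                  -- `light` measures against the recorded size `a`, but `half-clean` against the
                  -- current set; a ≤ 2^h |A| converts one into the other.
                  (≤-trans (*-monoʳ-≤ K′ (proj₂ (proj₂ (proj₂ (All.lookup LX-sized e∈)))))
                           (≤-reflexive (sym (*-assoc K′ (2 ^ h) (length A))))) }) LY-sized)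
        (≤-trans (≤-reflexive (cong (λ l → 2 * (l * (K′ * 2 ^ h))) lenY)) K-large)

      light′ : ∀ {A x B b} → (B , b) ∈ LY → x ∈ filter Light′? A → K′ * count (R? x) B ≤ b
      light′ {A} {x} {B} {b} f∈ x∈ = decidable-stable (K′ * count (R? x) B ≤? b)
        (All.lookup (proj₂ (∈-filter⁻ Light′? {xs = A} x∈)) f∈)

module _ {n : ℕ} (T : Digraph (Fin n)) where
  open Digraph T

  module _ (K′ : ℕ) where

    -- Both fields bound edges from the later set `f` back to the earlier `e`, once per endpoint.
    -- Measuring against recorded sizes makes the relation survive shrinking either set.
    record Near (e f : Entry n) : Set where
      constructor near
      field
        apart    : Disjoint (proj₁ e) (proj₁ f)
        few-in   : ∀ {x} → x ∈ proj₁ e → K′ * count (λ y → E? y x) (proj₁ f) ≤ proj₂ f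
        few-out  : ∀ {y} → y ∈ proj₁ f → K′ * count (E? y) (proj₁ e) ≤ proj₂ e
    open Near public

    near-restrictˡ : ∀ {P : Fin n → Set} (P? : U.Decidable P) {e f} → Near e f → Near (restrict P? e) f
    near-restrictˡ P? {A , _} (near d i o) = near
      (λ (p , q) → d (filter-⊆ P? A p , q))
      (i ∘ filter-⊆ P? A)
      (λ {y} y∈ → ≤-trans (*-monoʳ-≤ K′ (count-filter-≤ (E? y) P? A)) (o y∈))

    near-restrictʳ : ∀ {P : Fin n → Set} (P? : U.Decidable P) {e f} → Near e f → Near e (restrict P? f)
    near-restrictʳ P? {_} {B , _} (near d i o) = near
      (λ (p , q) → d (p , filter-⊆ P? B q))
      (λ {x} x∈ → ≤-trans (*-monoʳ-≤ K′ (count-filter-≤ (λ y → E? y x) P? B)) (i x∈))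
      (o ∘ filter-⊆ P? B)

    nears-restrict : ∀ {P : Fin n → Set} (P? : U.Decidable P) {L} → AllPairs Near L → AllPairs Near (map (restrict P?) L)
    nears-restrict P? nears =
      AllPairs.map⁺ (AllPairs.map (near-restrictˡ P? ∘ near-restrictʳ P?) nears)

  module Sequence (tournament : IsTournament T) (r : ℕ) (no-path : ∀ {xs} → InducedPath T xs → ¬ suc r ≤ length xs)
    (m K K′ M : ℕ) .{{_ : NonZero K}} .{{_ : NonZero M}} (K′≤K : K′ ≤ K)
    (K-large : 2 * (m * (K′ * m)) ≤ K) (M-large : 2 * (m * K) ≤ M) where

    -- `q` is the loss of one sparse pair. `Q` adds a factor 2, as one level also halves each side
    -- at most once: the pieces of `X` in `Row`, the set `Y` in `Column`.
    q Q : ℕ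
    q = 2 * (4 * M ^ r)
    Q = 2 * q

    instance
      Q≢0 : NonZero Q
      Q≢0 = m*n≢0 2 q {{it}} {{m*n≢0 2 (4 * M ^ r) {{it}} {{m*n≢0 4 (M ^ r) {{it}} {{m^n≢0 M r}}}}}}

    -- The recorded size dates from the bottom of the recursion, and each of the `h` levels at most
    -- halves the set, hence `≤size`.
    record Part (h : ℕ) (W : List (Fin n)) (e : Entry n) : Set where
      field
        unique   : Unique (proj₁ e)
        subset   : proj₁ e ⊆ W
        size≤    : length (proj₁ e) ≤ proj₂ e
        ≤size    : proj₂ e ≤ 2 ^ h * length (proj₁ e)
        large    : length W ≤ Q ^ h * length (proj₁ e)
    open Part

    Parts : ℕ → List (Fin n) → Set
    Parts h W = ∃[ L ] length L ≡ 2 ^ h × All (Part h W) L × AllPairs (Near K′) L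

    -- The sequences found inside the two sides of a sparse pair are concatenated, so their number
    -- doubles at each level. A level costs at most a factor `Q`, so `Q ^ h ≤ length W` leaves at
    -- least two vertices wherever a pair is needed.
    parts : ∀ h W → Unique W → 2 ^ h ≤ m → Q ^ h ≤ length W → Parts h W
    parts zero W W! _ _ = (W , length W) ∷ [] , refl ,
      record { unique = W! ; subset = id ; size≤ = ≤-refl
             ; ≤size = ≤-reflexive (sym (+-identityʳ _)) ; large = ≤-reflexive (sym (+-identityʳ _)) } ∷ [] ,
      [] ∷ []
    parts (suc h) W W! 2ʰ⁺¹≤m Q≤W = result sparse
      where
      2ʰ≤m : 2 ^ h ≤ m
      2ʰ≤m = ≤-trans (m≤m+n _ _) 2ʰ⁺¹≤m

      2≤W : 2 ≤ length W
      2≤W = ≤-trans (*-mono-≤ {2} {Q} {1} (*-monoʳ-≤ 2 {1} {q} (>-nonZero⁻¹ q {{m*n≢0⇒n≢0 2}})) (m^n>0 Q h)) Q≤W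

      open SparsePair (sparse-pair T tournament M r W W! 2≤W no-path)

      K-large′ : 2 * (2 ^ h * (K′ * 2 ^ h)) ≤ K
      K-large′ = ≤-trans (*-monoʳ-≤ 2 (*-mono-≤ 2ʰ≤m (*-monoʳ-≤ K′ 2ʰ≤m))) K-large
      M-large′ : 2 * (2 ^ h * K) ≤ M
      M-large′ = ≤-trans (*-monoʳ-≤ 2 (*-monoˡ-≤ K 2ʰ≤m)) M-large

      descend : ∀ {z} → length W ≤ Q * z → Q ^ h ≤ z
      descend W≤ = *-cancelˡ-≤ Q (≤-trans Q≤W W≤)

      W≤QX : length W ≤ Q * length X
      W≤QX = ≤-trans X-large (*-monoˡ-≤ (length X) (m≤m+n q _))

      partsX : Parts h X
      partsX = parts h X X! 2ʰ≤m (descend W≤QX)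

      nonempty : ∀ {Z e} → Q ^ h ≤ length Z → Part h Z e → 0 < length (proj₁ e)
      nonempty {Z} {e} big p = n≢0⇒n>0 (λ A≡0 → <⇒≱ (m^n>0 Q h) (≤-trans big (≤-trans (large p)
        (≤-reflexive (trans (cong (Q ^ h *_) A≡0) (*-zeroʳ (Q ^ h)))))))

      module Merge {R : Rel (Fin n) 0ℓ} (R? : Decidable R)
                   (sparse : ∀ {x} → x ∈ X → M * count (R? x) Y ≤ length Y) where
        open Combine R? K K′ M h K-large′ M-large′ {X} {Y} sparse

        sized : ∀ {Z e} → Q ^ h ≤ length Z → Part h Z e → proj₁ e ⊆ Z × Sized e
        sized big p = subset p , nonempty big p , size≤ p , ≤size p

        LX : List (Entry n)
        LX = proj₁ partsX
        X-parts : All (Part h X) LX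
        X-parts = proj₁ (proj₂ (proj₂ partsX))
        X-sized : All (λ e → proj₁ e ⊆ X × Sized e) LX
        X-sized = All.map (sized (descend W≤QX)) X-parts

        open Column LX X-sized (proj₁ (proj₂ partsX)) renaming (Y′ to Z)

        Z⊆Y : Z ⊆ Y
        Z⊆Y = filter-⊆ _ Y

        W≤QZ : length W ≤ Q * length Z
        W≤QZ = begin
          length W              ≤⟨ Y-large ⟩
          q * length Y          ≤⟨ *-monoʳ-≤ q Y′-large ⟩
          q * (2 * length Z)    ≡⟨ solve 2 (λ q z → q :* (con 2 :* z) := con 2 :* q :* z) refl q (length Z) ⟩
          Q * length Z          ∎
          where
          open ≤-Reasoning
          open ℕ-Solver

        partsY : Parts h Z
        partsY = parts h Z (Unique.filter⁺ _ Y!) 2ʰ≤m (descend W≤QZ)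

        LY : List (Entry n)
        LY = proj₁ partsY
        Y-parts : All (Part h Z) LY
        Y-parts = proj₁ (proj₂ (proj₂ partsY))
        Y-sized : All (λ e → proj₁ e ⊆ Z × Sized e) LY
        Y-sized = All.map (sized (descend W≤QZ)) Y-parts

        open Row LY Y-sized (proj₁ (proj₂ partsY)) renaming (trim to cut)

        LX′ : List (Entry n)
        LX′ = map cut LX

        near-X : AllPairs (Near K′) LX′
        near-X = nears-restrict K′ _ (proj₂ (proj₂ (proj₂ partsX)))
        near-Y : AllPairs (Near K′) LY
        near-Y = proj₂ (proj₂ (proj₂ partsY))

        cross : ∀ {e f} → e ∈ LX → f ∈ LY →
                Disjoint (proj₁ (cut e)) (proj₁ f)
                × (∀ {x} → x ∈ proj₁ (cut e) → K′ * count (R? x) (proj₁ f) ≤ proj₂ f)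
                × (∀ {y} → y ∈ proj₁ f → K′ * count (flip R? y) (proj₁ (cut e)) ≤ proj₂ e)
        cross {A , a} {B , b} e∈ f∈ =
          (λ (p , s) → disjoint (subset (All.lookup X-parts e∈) (filter-⊆ _ A p) , Z⊆Y (subset (All.lookup Y-parts f∈) s))) ,
          light′ {A} f∈ ,
          (λ {y} y∈ → ≤-trans (*-mono-≤ K′≤K (count-filter-≤ (flip R? y) _ A))
             (light e∈ (subset (All.lookup Y-parts f∈) y∈)))

        parts-X : All (Part (suc h) W) LX′
        parts-X = All.map⁺ (All.tabulate (λ {e} e∈ → let p = All.lookup X-parts e∈ in record
          { unique = Unique.filter⁺ _ (unique p)
          ; subset = X⊆W ∘ subset p ∘ filter-⊆ _ (proj₁ e)
          ; size≤  = ≤-trans (length-filter _ (proj₁ e)) (size≤ p)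
          ; ≤size  = ≤-trans (≤size p) (≤-trans (*-monoʳ-≤ (2 ^ h) (trim-large e∈))
                       (≤-reflexive (solve 2 (λ t a → t :* (con 2 :* a) := con 2 :* t :* a) refl
                         (2 ^ h) (length (proj₁ (cut e))))))
          ; large  = begin
              length W                                    ≤⟨ X-large ⟩
              q * length X                                ≤⟨ *-monoʳ-≤ q (large p) ⟩
              q * (Q ^ h * length (proj₁ e))              ≤⟨ *-monoʳ-≤ q (*-monoʳ-≤ (Q ^ h) (trim-large e∈)) ⟩
              q * (Q ^ h * (2 * length (proj₁ (cut e))))
                ≡⟨ solve 3 (λ q t a → q :* (t :* (con 2 :* a)) := con 2 :* q :* t :* a) refl
                     q (Q ^ h) (length (proj₁ (cut e))) ⟩
              Q * Q ^ h * length (proj₁ (cut e))          ∎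
          }))
          where
          open ≤-Reasoning
          open ℕ-Solver

        parts-Y : All (Part (suc h) W) LY
        parts-Y = All.map (λ {e} p → record
          { unique = unique p
          ; subset = Y⊆W ∘ Z⊆Y ∘ subset p
          ; size≤  = size≤ p
          ; ≤size  = ≤-trans (≤size p) (*-monoˡ-≤ (length (proj₁ e)) (m≤m+n (2 ^ h) _))
          ; large  = ≤-trans W≤QZ (≤-trans (*-monoʳ-≤ Q (large p)) (≤-reflexive (sym (*-assoc Q (Q ^ h) _))))
          }) Y-parts

        lenX : length LX′ ≡ 2 ^ h
        lenX = trans (length-map cut LX) (proj₁ (proj₂ partsX))
        lenY : length LY ≡ 2 ^ h
        lenY = proj₁ (proj₂ partsY)

        total-length : ∀ {L₁ L₂ : List (Entry n)} → length L₁ ≡ 2 ^ h → length L₂ ≡ 2 ^ h → length (L₁ ++ L₂) ≡ 2 ^ suc h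
        total-length {L₁} l₁ l₂ = trans (length-++ L₁) (trans (cong₂ _+_ l₁ l₂) (cong ((2 ^ h) +_) (sym (+-identityʳ _))))

      result : (∀ {x} → x ∈ X → M * count (λ y → E? y x) Y ≤ length Y)
             ⊎ (∀ {x} → x ∈ X → M * count (E? x) Y ≤ length Y) → Parts (suc h) W
      -- The rare edges go from `Y` to `X` here, so the pieces of `X` come first; in the other case
      -- the order is reversed.
      result (inj₁ sp) = LX′ ++ LY , total-length {LX′} lenX lenY , All.++⁺ parts-X parts-Y ,
        AllPairs.++⁺ near-X near-Y (All.map⁺ (All.tabulate (λ e∈ → All.tabulate (λ f∈ →
          let (d , i , o) = cross e∈ f∈ in near d i o))))
        where open Merge (λ x y → E? y x) sp
      result (inj₂ sp) = LY ++ LX′ , total-length {LY} lenY lenX , All.++⁺ parts-Y parts-X ,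
        AllPairs.++⁺ near-Y near-X (All.tabulate (λ f∈ → All.map⁺ (All.tabulate (λ e∈ →
          let (d , i , o) = cross e∈ f∈ in near (λ (p , s) → d (s , p)) o i))))
        where open Merge E? sp

-- Embedding the path along the sequence, or finding a pure pair.

round-up-even : ∀ r → ∃[ j ] r ≤ j * 2 × j * 2 ≤ suc r
round-up-even zero          = 0 , z≤n , z≤n
round-up-even (suc zero)    = 1 , s≤s z≤n , ≤-refl
round-up-even (suc (suc r)) with round-up-even r
... | j , lo , hi = suc j , s≤s (s≤s lo) , s≤s (s≤s hi)

take-⊆ : ∀ {A : Set} m (xs : List A) → take m xs ⊆ xs
take-⊆ m xs p = subst (_ ∈_) (take++drop≡id m xs) (∈-++⁺ˡ p)

unique-⊆-length : ∀ {n} {xs ys : List (Fin n)} → Unique xs → xs ⊆ ys → length xs ≤ length ys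
unique-⊆-length []                 _   = z≤n
unique-⊆-length {xs = x ∷ xs} {ys} x!@(_ ∷ xs!) sub = ≤-trans
  (s≤s (unique-⊆-length xs! (λ p → ∈-filter⁺ ≢x? (sub (there p)) (λ { refl → Unique[x∷xs]⇒x∉xs x! p }))))
  (filter-notAll ≢x? ys (Any.map (λ x≡y y≢x → y≢x (sym x≡y)) (sub (here refl))))
  where
  ≢x? : U.Decidable (_≢ x)
  ≢x? y = ¬? (y Fin.≟ x)

module _ {n : ℕ} (T : Digraph (Fin n)) (tournament : IsTournament T) where
  open Digraph T

  -- P_k is embedded along the ordering v₂ v₁ v₄ v₃ v₆ v₅ ⋯ of its vertices, in which
  -- the backward edges v₃ → v₂, v₅ → v₄, ⋯ form a matching.
  module Embed (W : List (Fin n)) (0<W : 0 < length W) (K′ θ : ℕ) .{{_ : NonZero K′}} where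

    -- A can still lose t batches of at most a / K′ vertices without becoming smaller than |W| / θ.
    record Room (t : ℕ) (e : Entry n) : Set where
      field
        unique : Unique (proj₁ e)
        subset : proj₁ e ⊆ W
        space  : K′ * length W + θ * (t * proj₂ e) ≤ θ * (K′ * length (proj₁ e))
    open Room

    room-large : ∀ {t e} → Room t e → length W ≤ θ * length (proj₁ e)
    room-large {t} {A , a} R = *-cancelˡ-≤ K′ (≤-trans (≤-trans (m≤m+n _ _) (space R))
      (≤-reflexive (solve 3 (λ t k a → t :* (k :* a) := k :* (t :* a)) refl θ K′ (length A))))
      where open ℕ-Solver

    -- All lost vertices satisfy `B`, so they form a single batch of at most `a / K′` and use up one
    -- unit of `t`.
    room-restrict : ∀ {t e} {P B : Fin n → Set} (P? : U.Decidable P) (B? : U.Decidable B) →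
                    (∀ {x} → x ∈ proj₁ e → ¬ P x → B x) → K′ * count B? (proj₁ e) ≤ proj₂ e →
                    Room (suc t) e → Room t (restrict P? e)
    room-restrict {t} {A , a} P? B? cover few R = record
      { unique = Unique.filter⁺ P? (unique R)
      ; subset = subset R ∘ filter-⊆ P? A
      ; space  = +-cancelˡ-≤ (θ * a) _ _ (begin
          θ * a + (K′ * length W + θ * (t * a))
            ≡⟨ solve 4 (λ θ a w s → θ :* a :+ (w :+ θ :* s) := w :+ θ :* (a :+ s)) refl θ a (K′ * length W) (t * a) ⟩
          K′ * length W + θ * (a + t * a)                   ≤⟨ space R ⟩
          θ * (K′ * length A)                               ≤⟨ *-monoʳ-≤ θ (*-monoʳ-≤ K′ (count-cover B? P? A cover)) ⟩
          θ * (K′ * (length A′ + count B? A))               ≡⟨ cong (θ *_) (*-distribˡ-+ K′ (length A′) _) ⟩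
          θ * (K′ * length A′ + K′ * count B? A)            ≤⟨ *-monoʳ-≤ θ (+-monoʳ-≤ _ few) ⟩
          θ * (K′ * length A′ + a)
            ≡⟨ solve 3 (λ θ b a → θ :* (b :+ a) := θ :* a :+ θ :* b) refl θ (K′ * length A′) a ⟩
          θ * a + θ * (K′ * length A′)                      ∎)
      }
      where
      open ≤-Reasoning
      open ℕ-Solver
      A′ : List (Fin n)
      A′ = filter P? A

    room-out : ∀ {t e f x} → x ∈ proj₁ e → Near T K′ e f → Room (suc t) f → Room t (restrict (E? x) f)
    room-out {x = x} x∈ nr = room-restrict (E? x) (λ z → E? z x)
      (λ z∈ → total T tournament (λ { refl → apart nr (x∈ , z∈) })) (few-in nr x∈)

    room-in : ∀ {t e f x} → x ∈ proj₁ f → Near T K′ e f → Room (suc t) e → Room t (restrict (λ z → E? z x) e)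
    room-in {x = x} x∈ nr = room-restrict (λ z → E? z x) (E? x)
      (λ z∈ → total T tournament (λ { refl → apart nr (z∈ , x∈) })) (few-out nr x∈)

    SetPath : ℕ → Entry n → List (Entry n) → Set
    SetPath l e L = ∃[ x ] ∃[ xs ] InducedPath T (x ∷ xs) × length xs ≡ l ×
                    x ∈ proj₁ e × All (λ z → Any (λ f → z ∈ proj₁ f) L) xs

    -- A round takes u, x, s from the sets `e`, `f`, `g` and puts them on the path in the order u,
    -- s, x. Only s → u runs backward along the sequence; `x` then serves as the head of the next
    -- round.
    embed : ∀ j e L → suc (j * 2) ≤ suc (length L) → AllPairs (Near T K′) (e ∷ L) →
            All (Room (j * 2)) (e ∷ L) → SetPath (j * 2) e L ⊎ PurePair T θ W
    embed zero ([] , a) L _ _ (room ∷ _) =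
      contradiction (≤-trans 0<W (≤-trans (room-large room) (≤-reflexive (*-zeroʳ θ)))) λ ()
    embed zero (x ∷ U , a) L _ _ _ = inj₁ (x , [] , [-] , refl , here refl , [])
    embed (suc j) e [] (s≤s ()) _ _
    embed (suc j) e (_ ∷ []) (s≤s (s≤s ())) _ _
    embed (suc j) e@(U , a) (f@(V , b) ∷ g@(S , c) ∷ L) (s≤s (s≤s len))
          ((ef ∷ eg ∷ eL) ∷ (fg ∷ fL) ∷ gL ∷ LL) (room-e ∷ room-f ∷ room-g ∷ room-L)
      with Any.any? (λ u → Any.any? (λ s → E? s u) S) U
    -- No edge at all goes from `S` to `U`, and the remaining room keeps both sets large.
    ... | no none = inj₂ (record
        { X = U ; Y = S ; X! = unique room-e ; Y! = unique room-g ; X⊆W = subset room-e ; Y⊆W = subset room-g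
        ; disjoint = apart eg ; X-large = room-large room-e ; Y-large = room-large room-g
        ; pure = λ x∈ y∈ yx → none (Any.map (λ { refl → Any.map (λ { refl → yx }) y∈ }) x∈) })
    ... | yes found with find found
    ...   | u , u∈U , found′ with find found′
    ...     | s , s∈S , su
      -- The next head must be beaten by `u` and beat `s`; all later vertices must be beaten by
      -- both. Every set loses two batches, matching the drop from suc j * 2 to j * 2.
      with embed j f′ (map cut L) (≤-trans len (s≤s (≤-reflexive (sym (length-map cut L)))))
             (All.map⁺ (All.map (near-restrictʳ T K′ (E? s) ∘ near-restrictʳ T K′ (E? u)
                                 ∘ near-restrictˡ T K′ (λ z → E? z s) ∘ near-restrictˡ T K′ (E? u)) fL)
              ∷ AllPairs.map⁺ (AllPairs.map (near-restrictʳ T K′ (E? s) ∘ near-restrictʳ T K′ (E? u)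
                                 ∘ near-restrictˡ T K′ (E? s) ∘ near-restrictˡ T K′ (E? u)) LL))
             (room-in s∈S (near-restrictˡ T K′ (E? u) fg) (room-out u∈U ef room-f)
              ∷ All.map⁺ (All.zipWith (λ ((eh , gh) , room) →
                  room-out s∈S (near-restrictʳ T K′ (E? u) gh) (room-out u∈U eh room))
                  (All.zip (eL , gL) , room-L)))
      where
      cut : Entry n → Entry n
      cut = restrict (E? s) ∘ restrict (E? u)
      f′ : Entry n
      f′ = restrict (λ z → E? z s) (restrict (E? u) f)
    ...       | inj₂ pair = inj₂ pair
    ...       | inj₁ (x , xs , path , l , x∈ , xs∈) =
      let (x∈′ , xs-edge)  = ∈-filter⁻ (λ z → E? z s) {xs = filter (E? u) V} x∈
          (x∈V , ux)       = ∈-filter⁻ (E? u) {xs = V} x∈′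
          away             = All.map (λ p → split (Any.map⁻ p)) xs∈
      in inj₁ (u , s ∷ x ∷ xs ,
           cons su (ux ∷ All.map proj₁ away) (cons xs-edge (All.map (proj₁ ∘ proj₂) away) path) ,
           cong (2 +_) l , u∈U ,
           there (here s∈S) ∷ here x∈V ∷ All.map (there ∘ there ∘ proj₂ ∘ proj₂) away)
      where
      split : ∀ {L z} → Any (λ h → z ∈ filter (E? s) (filter (E? u) (proj₁ h))) L → E u z × E s z × Any (λ h → z ∈ proj₁ h) L
      split {h ∷ _} (here p) =
        let (q , sz) = ∈-filter⁻ (E? s) {xs = filter (E? u) (proj₁ h)} p
            (r , uz) = ∈-filter⁻ (E? u) {xs = proj₁ h} q
        in uz , sz , here r
      split (there p) = let (uz , sz , r) = split p in uz , sz , there r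

  module _ (r H : ℕ) (no-path : ∀ {xs} → InducedPath T xs → ¬ suc r ≤ length xs) (r+2≤2ᴴ : 2 + r ≤ 2 ^ H) where

    private
      m K K′ M : ℕ
      m  = 2 ^ H
      -- At most `m` batches are removed from a set, each of at most a / K′ ≤ m |A| / K′ vertices,
      -- so the embedding removes at most half of it. `K` and `M` are then the least values that
      -- `Sequence` admits.
      K′ = 2 * (m * m)
      K  = 2 * (m * (K′ * m))
      M  = 2 * (m * K)

      instance
        m≢0 : NonZero m
        m≢0 = m^n≢0 2 H
        K′≢0 : NonZero K′
        K′≢0 = m*n≢0 2 (m * m) {{it}} {{m*n≢0 m m}}
        K≢0 : NonZero K
        K≢0 = m*n≢0 2 (m * (K′ * m)) {{it}} {{m*n≢0 m (K′ * m) {{it}} {{m*n≢0 K′ m}}}}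
        M≢0 : NonZero M
        M≢0 = m*n≢0 2 (m * K) {{it}} {{m*n≢0 m K}}

      K′≤K : K′ ≤ K
      K′≤K = ≤-trans (m≤m*n K′ m) (≤-trans (m≤n*m (K′ * m) m) (m≤m+n _ _))

      module S = Sequence T tournament r no-path m K K′ M K′≤K ≤-refl ≤-refl

    -- The factor 2 pays for the half of a set that the embedding may remove.
    ratio : ℕ
    ratio = 2 * S.Q ^ H

    -- The `r` greedy steps give the inner power and the `H` levels the outer one; with m = 2^H, the
    -- density parameter is M = 8 m^5.
    ratio≡ : ratio ≡ 2 ^ (1 + (4 + (3 + H * 5) * r) * H)
    ratio≡ = cong (2 *_) (begin
      S.Q ^ H                               ≡⟨ cong (_^ H) Q≡ ⟩
      (2 ^ (4 + (3 + H * 5) * r)) ^ H       ≡⟨ ^-*-assoc 2 (4 + (3 + H * 5) * r) H ⟩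
      2 ^ ((4 + (3 + H * 5) * r) * H)       ∎)
      where
      open ≡-Reasoning
      open ℕ-Solver
      M≡ : M ≡ 2 ^ (3 + H * 5)
      M≡ = begin
        M                    ≡⟨ solve 1 (λ m → con 2 :* (m :* (con 2 :* (m :* (con 2 :* (m :* m) :* m))))
                                  := con 2 :* (con 2 :* (con 2 :* (m :* (m :* (m :* (m :* (m :* con 1)))))))) refl m ⟩
        2 * (2 * (2 * m ^ 5)) ≡⟨ cong (λ z → 2 * (2 * (2 * z))) (^-*-assoc 2 H 5) ⟩
        2 ^ (3 + H * 5)      ∎
      Q≡ : S.Q ≡ 2 ^ (4 + (3 + H * 5) * r)
      Q≡ = begin
        2 * (2 * (4 * M ^ r))
          ≡⟨ solve 1 (λ x → con 2 :* (con 2 :* (con 4 :* x)) := con 2 :* (con 2 :* (con 2 :* (con 2 :* x)))) refl (M ^ r) ⟩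
        2 * (2 * (2 * (2 * M ^ r)))
          ≡⟨ cong (λ z → 2 * (2 * (2 * (2 * z)))) (trans (cong (_^ r) M≡) (^-*-assoc 2 (3 + H * 5) r)) ⟩
        2 ^ (4 + (3 + H * 5) * r)         ∎

    -- If `W` has fewer than Q^H vertices, two single vertices are already large enough and need
    -- only be ordered correctly. Otherwise the sequence exists, and an embedding would give a
    -- forbidden path.
    pure-pair : ∀ W → Unique W → 2 ≤ length W → PurePair T ratio W
    pure-pair W W! 2≤W with S.Q ^ H ≤? length W
    pure-pair (x ∷ []) W! (s≤s ()) | no _
    pure-pair (x ∷ y ∷ W) W!@((x≢y ∷ _) ∷ _) 2≤W | no ≰ = small (E? y x)
      where
      θ-large : length (x ∷ y ∷ W) ≤ ratio * 1
      θ-large = ≤-trans (<⇒≤ (≰⇒> ≰)) (≤-trans (m≤m+n _ _) (≤-reflexive (sym (*-identityʳ ratio))))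
      small : _ → PurePair T ratio (x ∷ y ∷ W)
      small (no ¬yx) = record
        { X = x ∷ [] ; Y = y ∷ [] ; X! = [] ∷ [] ; Y! = [] ∷ []
        ; X⊆W = λ { (here p) → here p } ; Y⊆W = λ { (here p) → there (here p) }
        ; disjoint = λ { (here refl , here refl) → x≢y refl } ; X-large = θ-large ; Y-large = θ-large
        ; pure = λ { (here refl) (here refl) → ¬yx } }
      small (yes yx) = record
        { X = y ∷ [] ; Y = x ∷ [] ; X! = [] ∷ [] ; Y! = [] ∷ []
        ; X⊆W = λ { (here p) → there (here p) } ; Y⊆W = λ { (here p) → here p }
        ; disjoint = λ { (here refl , here refl) → x≢y refl } ; X-large = θ-large ; Y-large = θ-large
        ; pure = λ { (here refl) (here refl) → asym T tournament yx } }
    pure-pair W W! 2≤W | yes Q≤W with S.parts H W W! ≤-refl Q≤W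
    ... | [] , len , _ = contradiction (≤-trans r+2≤2ᴴ (≤-reflexive (sym len))) λ ()
    ... | e ∷ L , len , all-parts , nears
      -- `embed` adds vertices in pairs, so `r` is rounded up to an even number; 2 + r ≤ 2^H
      -- provides the extra set this may take.
      with round-up-even r
    ... | j , r≤2j , 2j≤ with embed j e L (≤-trans j-small (≤-reflexive (sym len))) nears (All.map room all-parts)
      where
      open Embed W (≤-trans (s≤s z≤n) 2≤W) K′ ratio
      j-small : suc (j * 2) ≤ m
      j-small = ≤-trans (s≤s 2j≤) r+2≤2ᴴ
      room : ∀ {e} → S.Part H W e → Room (j * 2) e
      room {A , a} p = record { unique = S.Part.unique p ; subset = S.Part.subset p ; space = begin
        K′ * length W + ratio * (j * 2 * a)
          ≤⟨ +-mono-≤ (*-monoʳ-≤ K′ (S.Part.large p))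
               (*-monoʳ-≤ ratio (*-mono-≤ (≤-trans (n≤1+n _) j-small) (S.Part.≤size p))) ⟩
        K′ * (S.Q ^ H * length A) + ratio * (m * (m * length A))
          ≡⟨ solve 3 (λ m Q a → con 2 :* (m :* m) :* (Q :* a) :+ con 2 :* Q :* (m :* (m :* a))
               := con 2 :* Q :* (con 2 :* (m :* m) :* a)) refl m (S.Q ^ H) (length A) ⟩
        ratio * (K′ * length A) ∎ }
        where
        open ≤-Reasoning
        open ℕ-Solver
    ...   | inj₂ pair = pair
    ...   | inj₁ (x , xs , path , l , _) = contradiction (s≤s (≤-trans r≤2j (≤-reflexive (sym l)))) (no-path path)

-- Recursive colouring from pure pairs.

module _ {n : ℕ} (T : Digraph (Fin n)) where
  open Digraph T
  open DecMembership (Fin._≟_ {n}) using (_∈?_)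

  -- Acyclicity is witnessed by a rank that rises along monochromatic edges, which is easier to
  -- combine than the absence of cycles. `bound` allows one set to be ranked above another.
  record RankedColouring (W : List (Fin n)) (a : ℕ) : Set where
    field
      colour     : Fin n → ℕ
      rank       : Fin n → ℕ
      bound      : ℕ
      colour<    : ∀ {v} → v ∈ W → colour v < a
      rank<      : ∀ {v} → v ∈ W → rank v < bound
      increasing : ∀ {u v} → u ∈ W → v ∈ W → colour u ≡ colour v → E u v → rank u < rank v

  module _ {X Y : List (Fin n)} where
    open RankedColouring

    private
      in-Y : ∀ {v} → v ∈ X ++ Y → ¬ v ∈ X → v ∈ Y
      in-Y v∈ v∉X with ∈-++⁻ X v∈
      ... | inj₁ p = contradiction p v∉X
      ... | inj₂ q = q

    -- Both sets share one palette. Ranking `Y` above all of `X` makes the edges from `X` to `Y`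
    -- rise, and none go back.
    union-pure : ∀ {a b} → (∀ {x y} → x ∈ X → y ∈ Y → ¬ E y x) →
                 RankedColouring X a → RankedColouring Y b → RankedColouring (X ++ Y) (a ⊔ b)
    union-pure {a} {b} pure cx cy = record
      { colour = c ; rank = ρ ; bound = bound cx + bound cy ; colour< = c< ; rank< = ρ< ; increasing = inc }
      where
      c ρ : Fin n → ℕ
      c v with v ∈? X
      ... | yes _ = colour cx v
      ... | no  _ = colour cy v
      ρ v with v ∈? X
      ... | yes _ = rank cx v
      ... | no  _ = bound cx + rank cy v
      c< : ∀ {v} → v ∈ X ++ Y → c v < a ⊔ b
      c< {v} v∈ with v ∈? X
      ... | yes p = <-≤-trans (colour< cx p) (m≤m⊔n a b)
      ... | no ¬p = <-≤-trans (colour< cy (in-Y v∈ ¬p)) (m≤n⊔m a b)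
      ρ< : ∀ {v} → v ∈ X ++ Y → ρ v < bound cx + bound cy
      ρ< {v} v∈ with v ∈? X
      ... | yes p = <-≤-trans (rank< cx p) (m≤m+n _ _)
      ... | no ¬p = +-monoʳ-< (bound cx) (rank< cy (in-Y v∈ ¬p))
      inc : ∀ {u v} → u ∈ X ++ Y → v ∈ X ++ Y → c u ≡ c v → E u v → ρ u < ρ v
      inc {u} {v} u∈ v∈ eq uv with u ∈? X | v ∈? X
      ... | yes p | yes q = increasing cx p q eq uv
      ... | yes p | no _  = <-≤-trans (rank< cx p) (m≤m+n _ _)
      ... | no ¬p | yes q = contradiction uv (pure q (in-Y u∈ ¬p))
      ... | no ¬p | no ¬q = +-monoʳ-< (bound cx) (increasing cy (in-Y u∈ ¬p) (in-Y v∈ ¬q) eq uv)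

    -- Shifting the colours of `Y` by `a` separates the palettes, so edges between the two sets are
    -- never monochromatic and the ranks stay as they are.
    union : ∀ {a b} → RankedColouring X a → RankedColouring Y b → RankedColouring (X ++ Y) (a + b)
    union {a} {b} cx cy = record
      { colour = c ; rank = ρ ; bound = bound cx ⊔ bound cy ; colour< = c< ; rank< = ρ< ; increasing = inc }
      where
      c ρ : Fin n → ℕ
      c v with v ∈? X
      ... | yes _ = colour cx v
      ... | no  _ = a + colour cy v
      ρ v with v ∈? X
      ... | yes _ = rank cx v
      ... | no  _ = rank cy v
      c< : ∀ {v} → v ∈ X ++ Y → c v < a + b
      c< {v} v∈ with v ∈? X
      ... | yes p = <-≤-trans (colour< cx p) (m≤m+n a b)
      ... | no ¬p = +-monoʳ-< a (colour< cy (in-Y v∈ ¬p))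
      ρ< : ∀ {v} → v ∈ X ++ Y → ρ v < bound cx ⊔ bound cy
      ρ< {v} v∈ with v ∈? X
      ... | yes p = <-≤-trans (rank< cx p) (m≤m⊔n _ _)
      ... | no ¬p = <-≤-trans (rank< cy (in-Y v∈ ¬p)) (m≤n⊔m _ _)
      inc : ∀ {u v} → u ∈ X ++ Y → v ∈ X ++ Y → c u ≡ c v → E u v → ρ u < ρ v
      inc {u} {v} u∈ v∈ eq uv with u ∈? X | v ∈? X
      ... | yes p | yes q = increasing cx p q eq uv
      ... | yes p | no _  = contradiction (<-≤-trans (colour< cx p) (m≤m+n a _)) (<-irrefl eq)
      ... | no _  | yes q = contradiction (<-≤-trans (colour< cx q) (m≤m+n a _)) (<-irrefl (sym eq))
      ... | no ¬p | no ¬q = increasing cy (in-Y u∈ ¬p) (in-Y v∈ ¬q) (+-cancelˡ-≡ a _ _ eq) uv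

  colouring-⊆ : ∀ {W W′ a} → W ⊆ W′ → RankedColouring W′ a → RankedColouring W a
  colouring-⊆ sub c = record
    { colour = colour ; rank = rank ; bound = bound ; colour< = colour< ∘ sub ; rank< = rank< ∘ sub
    ; increasing = λ u∈ v∈ → increasing (sub u∈) (sub v∈) }
    where open RankedColouring c

  -- With N + 1 = 2e the exponent N / (N + 1) is 1 - 1/(2e). The two sides of a pure pair share a
  -- palette, the rest gets fresh colours, and `power-sum` bounds the total.
  colouring : ∀ {θ} e N → e + e ≡ suc N → 3 ≤ N → θ ≤ 2 ^ e →
              (∀ W → Unique W → 2 ≤ length W → PurePair T θ W) →
              ∀ l W → Unique W → length W ≤ l → ∃[ a ] RankedColouring W a × a ^ suc N ≤ length W ^ N
  colouring e N eq 3≤N θ≤ pair l [] _ _ = 0 , record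
    { colour = λ _ → 0 ; rank = λ _ → 0 ; bound = 0 ; colour< = λ () ; rank< = λ () ; increasing = λ () } , z≤n
  colouring e N eq 3≤N θ≤ pair l (x ∷ []) _ _ = 1 , record
    { colour = λ _ → 0 ; rank = λ _ → 0 ; bound = 1 ; colour< = λ _ → s≤s z≤n ; rank< = λ _ → s≤s z≤n
    ; increasing = λ { (here refl) (here refl) _ xx → contradiction xx (irrefl x) } } ,
    ≤-reflexive (trans (^-zeroˡ (suc N)) (sym (^-zeroˡ N)))
  colouring {θ} e N eq 3≤N θ≤ pair (suc l) W@(_ ∷ _ ∷ _) W! (s≤s W≤) = combine
    (colouring e N eq 3≤N θ≤ pair l X′ (Unique.take⁺ m X!) (≤-trans (≤-reflexive lenX) m≤l))
    (colouring e N eq 3≤N θ≤ pair l Y′ (Unique.take⁺ m Y!) (≤-trans (≤-reflexive lenY) m≤l))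
    (colouring e N eq 3≤N θ≤ pair l Z (Unique.filter⁺ Outside? W!) Z≤l)
    where
    open PurePair (pair W W! (s≤s (s≤s z≤n)))
    -- Both sides are cut to a common size, so that the two inductive bounds become powers of the
    -- same `m`.
    m : ℕ
    m = length X ⊓ length Y
    X′ Y′ : List (Fin n)
    X′ = take m X
    Y′ = take m Y
    Outside? : U.Decidable (λ v → ¬ v ∈ X′ ++ Y′)
    Outside? v = ¬? (v ∈? X′ ++ Y′)
    Z : List (Fin n)
    Z = filter Outside? W
    lenX : length X′ ≡ m
    lenX = trans (length-take m X) (m≤n⇒m⊓n≡m (m⊓n≤m _ _))
    lenY : length Y′ ≡ m
    lenY = trans (length-take m Y) (m≤n⇒m⊓n≡m (m⊓n≤n _ _))
    X′⊆X : X′ ⊆ X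
    X′⊆X = take-⊆ m X
    Y′⊆Y : Y′ ⊆ Y
    Y′⊆Y = take-⊆ m Y

    W≤m : length W ≤ m * 2 ^ e
    W≤m = ≤-trans W≤θm (≤-trans (*-monoˡ-≤ m θ≤) (≤-reflexive (*-comm (2 ^ e) m)))
      where
      W≤θm : length W ≤ θ * m
      W≤θm with ⊓-sel (length X) (length Y)
      ... | inj₁ p = subst (λ z → length W ≤ θ * z) (sym p) X-large
      ... | inj₂ p = subst (λ z → length W ≤ θ * z) (sym p) Y-large

    1≤m : 1 ≤ m
    1≤m = n≢0⇒n>0 (λ m≡0 → contradiction (subst (λ z → length W ≤ z * 2 ^ e) m≡0 W≤m) λ ())

    fits : m + m + length Z ≤ length W
    fits = subst (_≤ length W)
      (trans (length-++ (X′ ++ Y′)) (cong (_+ length Z) (trans (length-++ X′) (cong₂ _+_ lenX lenY))))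
      (unique-⊆-length
        (Unique.++⁺ (Unique.++⁺ (Unique.take⁺ m X!) (Unique.take⁺ m Y!) (λ (p , q) → disjoint (X′⊆X p , Y′⊆Y q)))
          (Unique.filter⁺ Outside? W!) (λ (p , q) → proj₂ (∈-filter⁻ Outside? {xs = W} q) p))
        sub)
      where
      sub : (X′ ++ Y′) ++ Z ⊆ W
      sub p with ∈-++⁻ (X′ ++ Y′) p
      ... | inj₂ q = filter-⊆ Outside? W q
      ... | inj₁ q with ∈-++⁻ X′ q
      ...   | inj₁ q′ = X⊆W (X′⊆X q′)
      ...   | inj₂ q′ = Y⊆W (Y′⊆Y q′)

    m≤l : m ≤ l
    m≤l = ≤-pred (≤-trans (+-monoˡ-≤ m 1≤m) (≤-trans (≤-trans (m≤m+n (m + m) _) fits) (s≤s W≤)))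
    Z≤l : length Z ≤ l
    Z≤l = ≤-pred (≤-trans (+-monoˡ-≤ (length Z) (≤-trans 1≤m (m≤m+n m m))) (≤-trans fits (s≤s W≤)))

    covers : W ⊆ (X′ ++ Y′) ++ Z
    covers {v} v∈ with v ∈? (X′ ++ Y′)
    ... | yes p = ∈-++⁺ˡ p
    ... | no ¬p = ∈-++⁺ʳ (X′ ++ Y′) (∈-filter⁺ Outside? v∈ ¬p)

    combine : (∃[ a ] RankedColouring X′ a × a ^ suc N ≤ length X′ ^ N) →
              (∃[ a ] RankedColouring Y′ a × a ^ suc N ≤ length Y′ ^ N) →
              (∃[ a ] RankedColouring Z a × a ^ suc N ≤ length Z ^ N) →
              ∃[ a ] RankedColouring W a × a ^ suc N ≤ length W ^ N
    combine (a , ca , a≤) (b , cb , b≤) (c , cc , c≤) =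
      (a ⊔ b) + c ,
      colouring-⊆ covers (union (union-pure (λ p q → pure (X′⊆X p) (Y′⊆Y q)) ca cb) cc) ,
      subst (λ z → ((a ⊔ b) + c) ^ suc N ≤ z ^ N) sum≡
        (power-sum e (a ⊔ b) c m r N eq 3≤N (subst (_≤ m * 2 ^ e) (sym sum≡) W≤m) a⊔b≤
          (≤-trans c≤ (^-monoˡ-≤ N (m+n≤o⇒n≤o∸m fits))))
      where
      -- `power-sum` wants the size of `W` exactly as m + m + r, whereas `fits` only gives |Z| ≤ r.
      r : ℕ
      r = length W ∸ (m + m)
      sum≡ : m + m + r ≡ length W
      sum≡ = m+[n∸m]≡n (≤-trans (m≤m+n (m + m) (length Z)) fits)
      m+n≤o⇒n≤o∸m : m + m + length Z ≤ length W → length Z ≤ r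
      m+n≤o⇒n≤o∸m le = m+n≤o⇒m≤o∸n (length Z) {m + m} (≤-trans (≤-reflexive (+-comm (length Z) (m + m))) le)
      a⊔b≤ : (a ⊔ b) ^ suc N ≤ m ^ N
      a⊔b≤ with ⊔-sel a b
      ... | inj₁ p = subst₂ (λ y z → y ^ suc N ≤ z ^ N) (sym p) lenX a≤
      ... | inj₂ p = subst₂ (λ y z → y ^ suc N ≤ z ^ N) (sym p) lenY b≤

-- Return to the graph-theoretic definitions.

P-total : ∀ k {i j : Fin k} → i ≢ j → Digraph.E (P k) i j ⊎ Digraph.E (P k) j i
P-total k {i} {j} i≢j with toℕ i ≟ suc (toℕ j) | toℕ j ≟ suc (toℕ i) | <-cmp (toℕ i) (toℕ j)
... | yes p | _     | _            = inj₁ (inj₁ p)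
... | no _  | yes q | _            = inj₂ (inj₁ q)
... | no _  | no ¬q | tri< i<j _ _ = inj₁ (inj₂ (i<j , ¬q))
... | no _  | no _  | tri≈ _ eq _  = contradiction (Fin.toℕ-injective eq) i≢j
... | no ¬p | no _  | tri> _ _ j<i = inj₂ (inj₂ (j<i , ¬p))

∈-tabulate⁻ : ∀ {n} {Q : Fin n → Set} (Q? : U.Decidable Q) {v} → v Subset.∈ tabulate (does ∘ Q?) → Q v
∈-tabulate⁻ Q? {v} p with Q? v | trans (sym (lookup∘tabulate (does ∘ Q?) v)) ([]=⇒lookup p)
... | yes q | _  = q
... | no _  | ()

∈-tabulate⁺ : ∀ {n} {Q : Fin n → Set} (Q? : U.Decidable Q) {v} → Q v → v Subset.∈ tabulate (does ∘ Q?)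
∈-tabulate⁺ Q? {v} q = lookup⇒[]= v _ (trans (lookup∘tabulate (does ∘ Q?) v) (dec-true (Q? v) q))

-- 52 = 13 * 4: the coefficients on the left sum to 1 + 4 + 3 + 5, and (L + 1)² ≤ 4 L².
exponent : ∀ r L → 1 ≤ L → let H = suc L in
           1 + (4 + (3 + H * 5) * r) * H ≤ 52 * (suc r * (L * L))
exponent r L 1≤L = begin
  1 + (4 + (3 + H * 5) * r) * H
    ≤⟨ +-monoʳ-≤ 1 (*-monoˡ-≤ H (+-monoʳ-≤ 4 (*-monoʳ-≤ (3 + H * 5) (n≤1+n r)))) ⟩
  1 + (4 + (3 + H * 5) * k) * H
    ≤⟨ m≤m+n _ (h * h + 2 * h + r * H * H + 4 * (h * (h + 1) + r * H * H) + 3 * (k * (h * H))) ⟩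
  1 + (4 + (3 + H * 5) * k) * H + (h * h + 2 * h + r * H * H + 4 * (h * (h + 1) + r * H * H) + 3 * (k * (h * H)))
    ≡⟨ solve 2 (λ r h → let H = con 1 :+ h ; k = con 1 :+ r in
         con 1 :+ (con 4 :+ (con 3 :+ H :* con 5) :* k) :* H :+
           (h :* h :+ con 2 :* h :+ r :* H :* H :+ con 4 :* (h :* (h :+ con 1) :+ r :* H :* H) :+ con 3 :* (k :* (h :* H)))
         := con 13 :* (k :* (H :* H))) refl r h ⟩
  13 * (k * (H * H))
    ≤⟨ *-monoʳ-≤ 13 (*-monoʳ-≤ k (*-mono-≤ H≤2L H≤2L)) ⟩
  13 * (k * ((L + L) * (L + L)))
    ≡⟨ solve 2 (λ k L → con 13 :* (k :* ((L :+ L) :* (L :+ L))) := con 52 :* (k :* (L :* L))) refl k L ⟩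
  52 * (k * (L * L)) ∎
  where
  open ≤-Reasoning
  open ℕ-Solver
  h H k : ℕ
  h = L
  H = suc L
  k = suc r
  H≤2L : H ≤ L + L
  H≤2L = +-monoˡ-≤ L 1≤L

steps-≤ : ∀ l (g : Fin (suc l) → ℕ) → (∀ i → g (inject₁ i) < g (suc i)) → g zero ≤ g (fromℕ l)
steps-≤ zero    g h = ≤-refl
steps-≤ (suc l) g h = ≤-trans (<⇒≤ (h zero)) (steps-≤ l (g ∘ suc) (h ∘ suc))

module _ {n : ℕ} (T : Digraph (Fin n)) (tournament : IsTournament T) where
  open Digraph T
  open DecMembership (Fin._≟_ {n}) using (_∈?_)

  path-edge : ∀ {xs} → InducedPath T xs → ∀ i j → Digraph.E (P (length xs)) i j → E (lookup xs i) (lookup xs j)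
  path-edge [-] zero zero e = contradiction e (Digraph.irrefl (P 1) zero)
  path-edge (cons {zs = zs} _ _ _) zero zero e = contradiction e (Digraph.irrefl (P (2 + length zs)) zero)
  path-edge (cons _ _ _) zero (suc zero) (inj₂ (_ , ≢1)) = contradiction refl ≢1
  path-edge (cons {zs = zs} _ a _) zero (suc (suc j)) _ = All.lookup a (∈-lookup j)
  path-edge (cons yx _ _) (suc zero) zero _ = yx
  path-edge (cons _ _ p) (suc i) (suc j) (inj₁ eq) = path-edge p i j (inj₁ (suc-injective eq))
  path-edge (cons _ _ p) (suc i) (suc j) (inj₂ (s≤s i<j , ≢)) = path-edge p i j (inj₂ (i<j , ≢ ∘ cong suc))

  -- An edge-preserving map from `P` to `T` is injective and reflects edges: any other pair carries
  -- an edge of `P` by `P-total`, whose image contradicts irreflexivity or asymmetry.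
  path⇒P : ∀ {xs} → InducedPath T xs → ∃[ S ] (T [ S ]) ≅ P (length xs)
  path⇒P {xs} path = S , record
    { bijection = mk↔ₛ′ to from to∘from from∘to
    ; edges     = λ u v → mk⇔
        (λ uv → reflect (subst₂ E (sym (f∘to u)) (sym (f∘to v)) uv))
        (λ e → subst₂ E (f∘to u) (f∘to v) (path-edge path (to u) (to v) e))
    }
    where
    f : Fin (length xs) → Fin n
    f = lookup xs
    S : Subset n
    S = tabulate (does ∘ (_∈? xs))
    mem : (u : ∃[ v ] v Subset.∈ S) → proj₁ u ∈ xs
    mem (v , p) = ∈-tabulate⁻ (_∈? xs) p
    to : (∃[ v ] v Subset.∈ S) → Fin (length xs)
    to u = Any.index (mem u)
    from : Fin (length xs) → ∃[ v ] v Subset.∈ S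
    from i = f i , ∈-tabulate⁺ (_∈? xs) (∈-lookup i)
    f∘to : ∀ u → f (to u) ≡ proj₁ u
    f∘to u = sym (Any.lookup-index (mem u))
    f-injective : ∀ {i j} → f i ≡ f j → i ≡ j
    f-injective {i} {j} eq with i Fin.≟ j
    ... | yes i≡j = i≡j
    ... | no  i≢j with P-total (length xs) i≢j
    ...   | inj₁ e = contradiction (subst (E (f i)) (sym eq) (path-edge path i j e)) (irrefl (f i))
    ...   | inj₂ e = contradiction (subst (E (f j)) eq (path-edge path j i e)) (irrefl (f j))
    reflect : ∀ {i j} → E (f i) (f j) → Digraph.E (P (length xs)) i j
    reflect {i} {j} e with i Fin.≟ j
    ... | yes refl = contradiction e (irrefl (f i))
    ... | no  i≢j with P-total (length xs) i≢j
    ...   | inj₁ e′ = e′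
    ...   | inj₂ e′ = contradiction (path-edge path j i e′) (asym T tournament e)
    to∘from : ∀ i → to (from i) ≡ i
    to∘from i = f-injective (f∘to (from i))
    from∘to : ∀ u → from (to u) ≡ u
    from∘to u = ∈-≡ (f∘to u)
      where
      ∈-≡ : ∀ {u v : ∃[ v ] v Subset.∈ S} → proj₁ u ≡ proj₁ v → u ≡ v
      ∈-≡ {u , p} {.u , q} refl = cong (u ,_) ([]=-irrelevant p q)

  P-free⇒no-path : ∀ k → P k -free T → ∀ {xs} → InducedPath T xs → ¬ k ≤ length xs
  P-free⇒no-path k free {xs} path k≤ = free
    (subst (λ l → ∃[ S ] (T [ S ]) ≅ P l) (trans (length-take k xs) (m≤n⇒m⊓n≡m k≤)) (path⇒P (take-path T k path)))

  -- Along a monochromatic cycle the rank never falls below its start, yet the closing edge would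
  -- have to raise it back to that start.
  ranked⇒colorable : ∀ {a} → RankedColouring T (allFin n) a → AcyclicallyColorable T a
  ranked⇒colorable {a} ranked = c , acyclic
    where
    open RankedColouring ranked
    c : Fin n → Fin a
    c v = fromℕ< (colour< (∈-allFin v))
    same : ∀ {i u v} → c u ≡ i → c v ≡ i → colour u ≡ colour v
    same {u = u} {v} cu cv = trans (sym (Fin.toℕ-fromℕ< (colour< (∈-allFin u))))
      (trans (cong toℕ (trans cu (sym cv))) (Fin.toℕ-fromℕ< (colour< (∈-allFin v))))
    acyclic : IsAcyclicColoring T c
    acyclic i {l} f cycle = <⇒≱ (rises (f (fromℕ l)) (f zero) (IsDirectedCycle.close cycle))
      (steps-≤ l (rank ∘ proj₁ ∘ f) (λ j → rises (f (inject₁ j)) (f (suc j)) (IsDirectedCycle.step cycle j)))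
      where
      rises : ∀ u v → Digraph.E (T [ colorClass c i ]) u v → rank (proj₁ u) < rank (proj₁ v)
      rises (u , p) (v , q) = increasing (∈-allFin u) (∈-allFin v)
        (same (∈-tabulate⁻ (λ w → c w Fin.≟ i) p) (∈-tabulate⁻ (λ w → c w Fin.≟ i) q))

  -- Taking H = L + 1 turns k < 2^(L+1) into r + 2 ≤ 2^H, as k = r + 1. The constant 104 is twice
  -- the 52 of `exponent`, since N + 1 = 2e.
  χₐ-bound : ∀ k L → 1 ≤ L → 2 ^ L ≤ k → k < 2 ^ suc L → P k -free T →
             ∃[ N ] suc N ≡ 104 * (k * (L * L)) × χₐ T ^ suc N ≤ n ^ N
  χₐ-bound zero L _ 2ᴸ≤ _ _ = contradiction (≤-trans (m^n>0 2 L) 2ᴸ≤) λ ()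
  χₐ-bound k@(suc r) L 1≤L _ k< free =
    let no-path = P-free⇒no-path k free
        (a , ranked , a≤) = colouring T e N e+e≡ 3≤N
          (≤-trans (≤-reflexive (ratio≡ T tournament r (suc L) no-path k<)) (^-monoʳ-≤ 2 (exponent r L 1≤L)))
          (pure-pair T tournament r (suc L) no-path k<) n (allFin n) (Unique.allFin⁺ n) (≤-reflexive (length-tabulate id))
    in N , N≡ , (begin
      χₐ T ^ suc N            ≤⟨ ^-monoˡ-≤ (suc N) (proj₂ (proj₂ (dichromaticNumber T)) a (ranked⇒colorable ranked)) ⟩
      a ^ suc N               ≤⟨ a≤ ⟩
      length (allFin n) ^ N   ≡⟨ cong (_^ N) (length-tabulate id) ⟩
      n ^ N                   ∎)
    where
    open ≤-Reasoning
    open ℕ-Solver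
    e N : ℕ
    e = 52 * (k * (L * L))
    N = pred (104 * (k * (L * L)))
    1≤ : 1 ≤ k * (L * L)
    1≤ = *-mono-≤ {1} {k} (s≤s z≤n) (*-mono-≤ 1≤L 1≤L)
    104≤ : 104 ≤ 104 * (k * (L * L))
    104≤ = *-monoʳ-≤ 104 1≤
    N≡ : suc N ≡ 104 * (k * (L * L))
    N≡ = suc-pred (104 * (k * (L * L))) {{>-nonZero (≤-trans (s≤s z≤n) 104≤)}}
    e+e≡ : e + e ≡ suc N
    e+e≡ = trans (solve 1 (λ x → con 52 :* x :+ con 52 :* x := con 104 :* x) refl (k * (L * L))) (sym N≡)
    3≤N : 3 ≤ N
    3≤N = ≤-pred (≤-trans (m≤m+n 4 100) (≤-trans 104≤ (≤-reflexive (sym N≡))))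

-- From the integer inequality to real numbers as cuts.

fromℚ-isDedekind : ∀ p → IsDedekind (fromℚ p)
fromℚ-isDedekind p = record
  { lower-inhabited = p ℚ.- 1ℚ ,
      subst (p ℚ.- 1ℚ ℚ.<_) (ℚ.+-identityʳ p) (ℚ.+-monoʳ-< p (ℚ.negative⁻¹ (ℚ.- 1ℚ)))
  ; upper-inhabited = p ℚ.+ 1ℚ ,
      subst (ℚ._< p ℚ.+ 1ℚ) (ℚ.+-identityʳ p) (ℚ.+-monoʳ-< p (ℚ.positive⁻¹ 1ℚ))
  ; lower-rounded = λ q → mk⇔ ℚ.<-dense (λ (_ , q<r , r<p) → ℚ.<-trans q<r r<p)
  ; upper-rounded = λ q → mk⇔ (λ p<q → let (r , p<r , r<q) = ℚ.<-dense p<q in r , r<q , p<r)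
                              (λ (_ , r<q , p<r) → ℚ.<-trans p<r r<q)
  ; disjoint = λ q (q<p , p<q) → ℚ.<-asym q<p p<q
  ; located = located
  }
  where
  located : ∀ q r → q ℚ.< r → q ℚ.< p ⊎ p ℚ.< r
  located q r q<r with q ℚ.<? p
  ... | yes q<p = inj₁ q<p
  ... | no  q≮p = inj₂ (ℚ.≤-<-trans (ℚ.≮⇒≥ q≮p) q<r)

≤ℚ⇒≯ℚ : ∀ {p q} → p ℚ.≤ q → ¬ q ℚ.< p
≤ℚ⇒≯ℚ p≤q q<p = ℚ.<-irrefl refl (ℚ.<-≤-trans q<p p≤q)

private
  ι : ℕ → ℚ
  ι = fromℕ→ℚ

-- For a variable `a` the fraction a / 1 is stuck on its normalisation; the explicit form computes.
ι≡mkℚ : ∀ a → ι a ≡ mkℚ (ℤ.+ a) 0 (Coprime.sym (1-coprimeTo a))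
ι≡mkℚ a = ℚ.normalize-coprime (Coprime.sym (1-coprimeTo a))

ι-mono-≤ : ∀ {a b} → a ℕ.≤ b → ι a ℚ.≤ ι b
ι-mono-≤ {a} {b} a≤b = subst₂ ℚ._≤_ (sym (ι≡mkℚ a)) (sym (ι≡mkℚ b))
  (*≤* (ℤ.*-monoʳ-≤-nonNeg (ℤ.+ 1) (ℤ.+≤+ a≤b)))

ι-cancel-< : ∀ {a b} → ι a ℚ.< ι b → a ℕ.< b
ι-cancel-< {a} {b} lt = ℕ.≰⇒> (λ b≤a → ≤ℚ⇒≯ℚ (ι-mono-≤ b≤a) lt)

ι-* : ∀ a b → ι (a ℕ.* b) ≡ ι a ℚ.* ι b
ι-* a b = trans (cong (ℚ._/ 1) (ℤ.pos-* a b)) (sym (cong₂ ℚ._*_ (ι≡mkℚ a) (ι≡mkℚ b)))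

ι-+ : ∀ a b → ι (a ℕ.+ b) ≡ ι a ℚ.+ ι b
ι-+ a b = trans (cong (ℚ._/ 1) (sym (cong₂ ℤ._+_ (ℤ.*-identityʳ (ℤ.+ a)) (ℤ.*-identityʳ (ℤ.+ b)))))
  (sym (cong₂ ℚ._+_ (ι≡mkℚ a) (ι≡mkℚ b)))

ι-^ : ∀ a d → ι a ^ℚ d ≡ ι (a ℕ.^ d)
ι-^ a zero    = refl
ι-^ a (suc d) = trans (cong (ι a ℚ.*_) (ι-^ a d)) (sym (ι-* a (a ℕ.^ d)))

0≤ι : ∀ a → 0ℚ ℚ.≤ ι a
0≤ι a = ι-mono-≤ {0} {a} ℕ.z≤n

*ℚ-mono-≤ : ∀ {p q r s} → 0ℚ ℚ.≤ p → 0ℚ ℚ.≤ s → p ℚ.≤ q → r ℚ.≤ s → p ℚ.* r ℚ.≤ q ℚ.* s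
*ℚ-mono-≤ {p} {q} {r} {s} 0≤p 0≤s p≤q r≤s = ℚ.≤-trans
  (ℚ.*-monoˡ-≤-nonNeg p {{nonNegative 0≤p}} r≤s) (ℚ.*-monoʳ-≤-nonNeg s {{nonNegative 0≤s}} p≤q)

^ℚ-mono-≤ : ∀ {p q} → 0ℚ ℚ.≤ p → p ℚ.≤ q → ∀ d → p ^ℚ d ℚ.≤ q ^ℚ d
^ℚ-mono-≤ 0≤p p≤q zero    = ℚ.≤-refl
^ℚ-mono-≤ {p} {q} 0≤p p≤q (suc d) = *ℚ-mono-≤ 0≤p (nonneg d) p≤q (^ℚ-mono-≤ 0≤p p≤q d)
  where
  nonneg : ∀ d → 0ℚ ℚ.≤ q ^ℚ d
  nonneg zero    = ℚ.nonNegative⁻¹ 1ℚ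
  nonneg (suc d) = subst (ℚ._≤ q ^ℚ suc d) (ℚ.*-zeroˡ 0ℚ)
    (*ℚ-mono-≤ ℚ.≤-refl (nonneg d) (ℚ.≤-trans 0≤p p≤q) (nonneg d))

ι≤⇒cross : ∀ a b r → ι a ℚ.≤ r ℚ.* ι b → ℤ.+ a ℤ.* ℤ.+ (↧ₙ r) ℤ.≤ ↥ r ℤ.* ℤ.+ b
ι≤⇒cross a b r@record{} le = subst₂ ℤ._≤_
  (cong (λ z → ℤ.+ a ℤ.* ℤ.+ z) (ℕ.*-identityʳ (↧ₙ r))) (ℤ.*-identityʳ (↥ r ℤ.* ℤ.+ b))
  (ℚᵘ.drop-*≤* (ℚᵘ.≤-trans (ℚ.toℚᵘ-mono-≤ le′) (ℚᵘ.≤-reflexive (ℚ.toℚᵘ-homo-* r (mkℚ (ℤ.+ b) 0 (Coprime.sym (1-coprimeTo b)))))))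
  where
  le′ : mkℚ (ℤ.+ a) 0 (Coprime.sym (1-coprimeTo a)) ℚ.≤ r ℚ.* mkℚ (ℤ.+ b) 0 (Coprime.sym (1-coprimeTo b))
  le′ = subst₂ (λ x y → x ℚ.≤ r ℚ.* y) (ι≡mkℚ a) (ι≡mkℚ b) le

-- Lower bounds on a cut are phrased through its upper set. The greatest endpoint product is at
-- least a′ b′, whose factors dominate `p` and `q`.
*ᴿ-upper : ∀ {x y} p q → 0ℚ ℚ.≤ p → 0ℚ ℚ.≤ q → (∀ {r} → [ x ]< r → p ℚ.≤ r) → (∀ {r} → [ y ]< r → q ℚ.≤ r) →
           ∀ {r} → [ x *ᴿ y ]< r → p ℚ.* q ℚ.≤ r
*ᴿ-upper p q 0≤p 0≤q px qy {r} (a , a′ , b , b′ , ((_ , x<a′) , (_ , y<b′)) , lt) = begin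
  p ℚ.* q                                                       ≤⟨ *ℚ-mono-≤ 0≤p (ℚ.≤-trans 0≤q (qy y<b′)) (px x<a′) (qy y<b′) ⟩
  a′ ℚ.* b′                                                     ≤⟨ ℚ.p≤q⊔p (a′ ℚ.* b) (a′ ℚ.* b′) ⟩
  (a′ ℚ.* b) ℚ.⊔ (a′ ℚ.* b′)                                      ≤⟨ ℚ.p≤q⊔p ((a ℚ.* b) ℚ.⊔ (a ℚ.* b′)) _ ⟩
  ((a ℚ.* b) ℚ.⊔ (a ℚ.* b′)) ℚ.⊔ ((a′ ℚ.* b) ℚ.⊔ (a′ ℚ.* b′))         ≤⟨ ℚ.<⇒≤ lt ⟩
  r                                                             ∎
  where open ℚ.≤-Reasoning

-- For r = p/d above log k, 2^(L d) ≤ k^d < 2^p forces L d < p.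
log₂-upper : ∀ k L {r} → 2 ℕ.^ L ℕ.≤ k → [ log₂ k ]< r → ι L ℚ.≤ r
log₂-upper k L 2ᴸ≤k (inj₁ k<0) = contradiction k<0 (≤ℚ⇒≯ℚ (0≤ι k))
log₂-upper k L {r@(mkℚ (ℤ.+ p) d-1 c)} 2ᴸ≤k (inj₂ lt) =
  subst (ℚ._≤ r) (sym (ι≡mkℚ L)) (*≤* (subst₂ ℤ._≤_ (ℤ.pos-* L (suc d-1)) (sym (ℤ.*-identityʳ (ℤ.+ p))) (ℤ.+≤+ (ℕ.<⇒≤ Ld<p))))
  where
  kᵈ<2ᵖ : k ℕ.^ suc d-1 ℕ.< 2 ℕ.^ p
  kᵈ<2ᵖ = ι-cancel-< (subst (ℚ._< ι (2 ℕ.^ p)) (ι-^ k (suc d-1)) lt)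
  Ld<p : L ℕ.* suc d-1 ℕ.< p
  Ld<p = ℕ.≰⇒> (λ p≤ → ℕ.<⇒≱ kᵈ<2ᵖ (ℕ.≤-trans (ℕ.^-monoʳ-≤ 2 p≤)
    (ℕ.≤-trans (ℕ.≤-reflexive (sym (ℕ.^-*-assoc 2 L (suc d-1)))) (ℕ.^-monoˡ-≤ (suc d-1) 2ᴸ≤k))))
-- A negative r would give k^d < 2^(negative) ≤ 1, although k is at least 1.
log₂-upper k L {r@(mkℚ -[1+ p ] d-1 c)} 2ᴸ≤k (inj₂ lt) = contradiction (ℚ.<-≤-trans lt ≤1) (≤ℚ⇒≯ℚ 1≤)
  where
  1≤ : 1ℚ ℚ.≤ ι k ^ℚ suc d-1
  1≤ = subst (1ℚ ℚ.≤_) (sym (ι-^ k (suc d-1)))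
    (ι-mono-≤ {1} {k ℕ.^ suc d-1} (ℕ.m^n>0 k {{ℕ.>-nonZero (ℕ.≤-trans (ℕ.m^n>0 2 L) 2ᴸ≤k)}} (suc d-1)))
  1/m≤1 : ∀ m .{{_ : NonZero m}} → ℤ.+ 1 ℚ./ m ℚ.≤ 1ℚ
  1/m≤1 (suc m) = subst (ℚ._≤ 1ℚ) (sym (ℚ.normalize-coprime (1-coprimeTo (suc m))))
    (*≤* (ℤ.*-monoˡ-≤-nonNeg (ℤ.+ 1) (ℤ.+≤+ (ℕ.s≤s ℕ.z≤n))))
  ≤1 : (2 ^ℤ -[1+ p ]) ℚ.≤ 1ℚ
  ≤1 = 1/m≤1 (2 ℕ.^ suc p) {{ℕ.m^n≢0 2 (suc p)}}

-- A number `b` below 1/y comes with some r > y and b r < 1. Since Y ≤ r, nonnegative `b` satisfies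
-- b Y ≤ 1, so q Y ≤ c b Y ≤ c.
/ᴿ-lower : ∀ {c y} Y → 0ℚ ℚ.< c → 0ℚ ℚ.≤ Y → (∀ {r} → [ y ]< r → Y ℚ.≤ r) →
              ∀ {q} → q <[ fromℚ c /ᴿ y ] → q ℚ.* Y ℚ.≤ c
/ᴿ-lower {c} Y 0<c 0≤Y Y≤ {q} (a , a′ , b , b′ , ((a<c , c<a′) , ((r , y<r , br<1) , _)) , lt)
  with ℚ.≤-total 0ℚ b
... | inj₁ 0≤b = begin
  q ℚ.* Y              ≤⟨ ℚ.*-monoʳ-≤-nonNeg Y {{nonNegative 0≤Y}} (ℚ.≤-trans (ℚ.<⇒≤ q<ab)
                            (ℚ.*-monoʳ-≤-nonNeg b {{nonNegative 0≤b}} (ℚ.<⇒≤ a<c))) ⟩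
  c ℚ.* b ℚ.* Y        ≡⟨ ℚ.*-assoc c b Y ⟩
  c ℚ.* (b ℚ.* Y)      ≤⟨ ℚ.*-monoˡ-≤-nonNeg c {{nonNegative (ℚ.<⇒≤ 0<c)}}
                            (ℚ.≤-trans (ℚ.*-monoˡ-≤-nonNeg b {{nonNegative 0≤b}} (Y≤ y<r)) (ℚ.<⇒≤ br<1)) ⟩
  c ℚ.* 1ℚ             ≡⟨ ℚ.*-identityʳ c ⟩
  c                    ∎
  where
  open ℚ.≤-Reasoning
  q<ab : q ℚ.< a ℚ.* b
  q<ab = ℚ.<-≤-trans lt (ℚ.≤-trans (ℚ.p⊓q≤p _ _) (ℚ.p⊓q≤p _ _))
-- The sign of `a` is unknown, so the product with a′ > c > 0 is used to see that q is at most zero.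
... | inj₂ b≤0 = begin
  q ℚ.* Y              ≤⟨ ℚ.*-monoʳ-≤-nonNeg Y {{nonNegative 0≤Y}} (ℚ.≤-trans (ℚ.<⇒≤ q<a′b) a′b≤0) ⟩
  0ℚ ℚ.* Y             ≡⟨ ℚ.*-zeroˡ Y ⟩
  0ℚ                   ≤⟨ ℚ.<⇒≤ 0<c ⟩
  c                    ∎
  where
  open ℚ.≤-Reasoning
  q<a′b : q ℚ.< a′ ℚ.* b
  q<a′b = ℚ.<-≤-trans lt (ℚ.≤-trans (ℚ.p⊓q≤q ((a ℚ.* b) ℚ.⊓ (a ℚ.* b′)) _) (ℚ.p⊓q≤p _ _))
  a′b≤0 : a′ ℚ.* b ℚ.≤ 0ℚ
  a′b≤0 = subst (a′ ℚ.* b ℚ.≤_) (ℚ.*-zeroʳ a′)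
    (ℚ.*-monoˡ-≤-nonNeg a′ {{nonNegative (ℚ.<⇒≤ (ℚ.<-trans 0<c c<a′))}} b≤0)

-- A rational q with n^x < q < χ yields p/d > x and n^p < q^d ≤ χ^d. But N d ≤ p (N + 1), so
-- comparing (N + 1)-st powers contradicts `bound`.
^ᴿ-lower-bound : ∀ n χ N .{{_ : NonZero n}} {x} → χ ℕ.^ suc N ℕ.≤ n ℕ.^ N →
                 (∀ {r} → [ x ]< r → ι N ℚ.≤ r ℚ.* ι (suc N)) → fromℕᴿ χ ≤ᴿ n ^ᴿ x
^ᴿ-lower-bound n χ N bound x≥ (q , (r@(mkℚ -[1+ p ] d-1 c) , x<r , _) , _) =
  contradiction (subst (ℤ._≤ -[1+ p ] ℤ.* ℤ.+ suc N) (sym (ℤ.pos-* N (suc d-1))) (ι≤⇒cross N (suc N) r (x≥ x<r))) λ ()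
^ᴿ-lower-bound n χ N bound x≥ (q , (r@(mkℚ (ℤ.+ p) d-1 c) , x<r , 0<q , lt) , q<χ) =
  ℕ.<⇒≱ nᵖ<χᵈ (^-cancelʳ-≤ (suc N) _ _ (begin
    (χ ℕ.^ d) ℕ.^ suc N    ≡⟨ trans (ℕ.^-*-assoc χ d (suc N)) (trans (cong (χ ℕ.^_) (ℕ.*-comm d (suc N)))
                                (sym (ℕ.^-*-assoc χ (suc N) d))) ⟩
    (χ ℕ.^ suc N) ℕ.^ d    ≤⟨ ℕ.^-monoˡ-≤ d bound ⟩
    (n ℕ.^ N) ℕ.^ d        ≡⟨ ℕ.^-*-assoc n N d ⟩
    n ℕ.^ (N ℕ.* d)        ≤⟨ ℕ.^-monoʳ-≤ n Nd≤ ⟩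
    n ℕ.^ (p ℕ.* suc N)    ≡⟨ ℕ.^-*-assoc n p (suc N) ⟨
    (n ℕ.^ p) ℕ.^ suc N    ∎))
  where
  open ℕ.≤-Reasoning
  d : ℕ
  d = suc d-1
  nᵖ<χᵈ : n ℕ.^ p ℕ.< χ ℕ.^ d
  nᵖ<χᵈ = ι-cancel-< (ℚ.<-≤-trans lt (subst (q ^ℚ d ℚ.≤_) (ι-^ χ d) (^ℚ-mono-≤ (ℚ.<⇒≤ 0<q) (ℚ.<⇒≤ q<χ) d)))
  Nd≤ : N ℕ.* d ℕ.≤ p ℕ.* suc N
  Nd≤ = ℤ.drop‿+≤+ (subst₂ ℤ._≤_ (sym (ℤ.pos-* N d)) (sym (ℤ.pos-* p (suc N))) (ι≤⇒cross N (suc N) r (x≥ x<r)))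

-- This is 1 - 1/(N+1) = N/(N+1), cleared of denominators.
1-upper : ∀ N {z} → (∀ {q} → q <[ z ] → q ℚ.* ι (suc N) ℚ.≤ 1ℚ) →
          ∀ {r} → [ fromℕᴿ 1 -ᴿ z ]< r → ι N ℚ.≤ r ℚ.* ι (suc N)
1-upper N z≤ (a , b , 1<a , b<z , refl) = begin
  ι N                              ≡⟨ solve 1 (λ x → x := con 1ℚ :+ x :- con 1ℚ) refl (ι N) ⟩
  1ℚ ℚ.+ ι N ℚ.- 1ℚ                ≡⟨ cong (ℚ._- 1ℚ) (ι-+ 1 N) ⟨
  D ℚ.- 1ℚ                         ≡⟨ cong (ℚ._- 1ℚ) (ℚ.*-identityˡ D) ⟨
  1ℚ ℚ.* D ℚ.- 1ℚ                  ≤⟨ ℚ.+-mono-≤ (ℚ.*-monoʳ-≤-nonNeg D {{nonNegative (0≤ι (suc N))}} (ℚ.<⇒≤ 1<a))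
                                        (ℚ.neg-antimono-≤ (z≤ b<z)) ⟩
  a ℚ.* D ℚ.- b ℚ.* D              ≡⟨ solve 3 (λ a b D → a :* D :- b :* D := (a :- b) :* D) refl a b D ⟩
  (a ℚ.- b) ℚ.* D                  ∎
  where
  open ℚ.≤-Reasoning
  open ℚ-Solver
  D : ℚ
  D = ι (suc N)

-- Because L ≤ log k, the subtracted term (1/104) / (k log² k) is at most 1 / (104 k L²) = 1/(N+1).
χ-bound⇒≤ᴿ : ∀ k L N χ n .{{_ : NonZero n}} → 2 ℕ.^ L ℕ.≤ k → suc N ≡ 104 ℕ.* (k ℕ.* (L ℕ.* L)) →
             χ ℕ.^ suc N ℕ.≤ n ℕ.^ N →
             fromℕᴿ χ ≤ᴿ n ^ᴿ (fromℕᴿ 1 -ᴿ fromℚ (ℤ.+ 1 ℚ./ 104) /ᴿ (fromℕᴿ k *ᴿ (log₂ k *ᴿ log₂ k)))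
χ-bound⇒≤ᴿ k L N χ n 2ᴸ≤k N≡ bound = ^ᴿ-lower-bound n χ N {fromℕᴿ 1 -ᴿ fromℚ (ℤ.+ 1 ℚ./ 104) /ᴿ y} bound
  (1-upper N {fromℚ (ℤ.+ 1 ℚ./ 104) /ᴿ y} small)
  where
  open ℚ.≤-Reasoning
  open ℚ-Solver
  y : Cut
  y = fromℕᴿ k *ᴿ (log₂ k *ᴿ log₂ k)
  denominator : ∀ {r} → [ y ]< r → ι (k ℕ.* (L ℕ.* L)) ℚ.≤ r
  denominator = subst (ℚ._≤ _) (sym (trans (ι-* k (L ℕ.* L)) (cong (ι k ℚ.*_) (ι-* L L))))
    ∘ *ᴿ-upper (ι k) (ι L ℚ.* ι L) (0≤ι k) (subst (0ℚ ℚ.≤_) (ι-* L L) (0≤ι (L ℕ.* L))) ℚ.<⇒≤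
        (*ᴿ-upper (ι L) (ι L) (0≤ι L) (0≤ι L) (log₂-upper k L 2ᴸ≤k) (log₂-upper k L 2ᴸ≤k))
  small : ∀ {q} → q <[ fromℚ (ℤ.+ 1 ℚ./ 104) /ᴿ y ] → q ℚ.* ι (suc N) ℚ.≤ 1ℚ
  small {q} q< = begin
    q ℚ.* ι (suc N)                              ≡⟨ cong (λ z → q ℚ.* ι z) N≡ ⟩
    q ℚ.* ι (104 ℕ.* (k ℕ.* (L ℕ.* L)))          ≡⟨ cong (q ℚ.*_) (ι-* 104 (k ℕ.* (L ℕ.* L))) ⟩
    q ℚ.* (ι 104 ℚ.* Y)                          ≡⟨ solve 3 (λ q c Y → q :* (c :* Y) := c :* (q :* Y)) refl q (ι 104) Y ⟩
    ι 104 ℚ.* (q ℚ.* Y)                          ≤⟨ ℚ.*-monoˡ-≤-nonNeg (ι 104)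
                                                      (/ᴿ-lower Y (ℚ.positive⁻¹ (ℤ.+ 1 ℚ./ 104)) (0≤ι (k ℕ.* (L ℕ.* L))) denominator q<) ⟩
    ι 104 ℚ.* (ℤ.+ 1 ℚ./ 104)                      ≡⟨⟩
    1ℚ                                           ∎
    where
    Y : ℚ
    Y = ι (k ℕ.* (L ℕ.* L))

theorem3p3 : ∃[ c ] IsDedekind c × fromℕᴿ 0 <ᴿ c ×
    (∀ (k : ℕ) → 2 ≤ k →
    ∀ (n : ℕ) .{{_ : NonZero n}} (T : Digraph (Fin n)) → IsTournament T → P k -free T →
    fromℕᴿ (χₐ T) ≤ᴿ n ^ᴿ (fromℕᴿ 1 -ᴿ c /ᴿ (fromℕᴿ k *ᴿ (log₂ k *ᴿ log₂ k))))
theorem3p3 = fromℚ (ℤ.+ 1 ℚ./ 104) , fromℚ-isDedekind (ℤ.+ 1 ℚ./ 104) , ℚ.<-dense (ℚ.positive⁻¹ (ℤ.+ 1 ℚ./ 104)) , bound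
  where
  bound : ∀ (k : ℕ) → 2 ≤ k →
    ∀ (n : ℕ) .{{_ : NonZero n}} (T : Digraph (Fin n)) → IsTournament T → P k -free T →
    fromℕᴿ (χₐ T) ≤ᴿ n ^ᴿ (fromℕᴿ 1 -ᴿ fromℚ (ℤ.+ 1 ℚ./ 104) /ᴿ (fromℕᴿ k *ᴿ (log₂ k *ᴿ log₂ k)))
  bound k 2≤k n T tournament free = from-log (binary-log k (≤-trans (n≤1+n 1) 2≤k))
    where
    from-log : ∃[ L ] 2 ^ L ≤ k × k < 2 ^ suc L →
      fromℕᴿ (χₐ T) ≤ᴿ n ^ᴿ (fromℕᴿ 1 -ᴿ fromℚ (ℤ.+ 1 ℚ./ 104) /ᴿ (fromℕᴿ k *ᴿ (log₂ k *ᴿ log₂ k)))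
    -- Since k ≥ 2, L is positive, as the estimate L + 1 ≤ 2L in `exponent` demands.
    from-log (zero  , _  , k<2) = contradiction k<2 (≤⇒≯ 2≤k)
    from-log (suc L , lo , hi)  =
      let (N , N≡ , χ≤) = χₐ-bound T tournament k (suc L) (s≤s z≤n) lo hi free
      in χ-bound⇒≤ᴿ k (suc L) N (χₐ T) n lo N≡ χ≤
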